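{- (1) $h(n,2K_2)=n$ for every $n\ge 7$; moreover $h(4,2K_2)=6$ and $h(5,2K_2)=h(6,2K_2)=7$. (2) For every integer $t\ge 3$ there exists $n_t$ such that for all $n\ge n_t$, $$h(n,tK_2)=\mathrm{ex}(n,tK_2)+t-1=(t-1)(n-t+1)+\binom{t-1}{2}+(t-1).$$
   Context: Let $H$ be a graph. Define $F_{H,1}$ as the set of maps $f:E(H)\to E(H)$ with $f(e)\neq e$ for every $e\in E(H)$, i.e. $|f(e)\cap e|\le 1$. Given such an $f$, a subgraph $G'$ of $H$ is called $f$-free if $f(e)\notin E(G')$ for every $e\in E(G')$. For a graph $G$ and an integer $n$, $h(n,G)$ denotes the maximum number of edges of an $n$-vertex graph $H$ for which some $f\in F_{H,1}$ exists such that $H$ contains no $f$-free copy of $G$. $\mathrm{ex}(n,G)$ is the Turán number, and $tK_2$ denotes a matching with $t$ edges. -}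

module Defs where

open import Data.Nat using (ℕ; _≤_)
open import Data.Fin using (Fin; _<_; _<?_)
open import Data.Bool using (Bool; true; false; _∧_)
open import Data.List using (List; length; filter; allFin; cartesianProduct)
open import Data.Product using (Σ; ∃; _×_; _,_; proj₁; proj₂)
open import Relation.Nullary using (¬_)
open import Relation.Nullary.Decidable using (_×-dec_)
open import Relation.Binary.PropositionalEquality using (_≡_; _≢_)
open import Data.Bool.Properties using () renaming (_≟_ to _≟B_)

record Graph (n : ℕ) : Set where
  field
    adj    : Fin n → Fin n → Bool
    sym    : ∀ i j → adj i j ≡ adj j i
    irrefl : ∀ i → adj i i ≡ false
open Graph public

-- An edge {i , j} is represented once, as an ordered pair with i < j.
Edge : ∀ {n} → Graph n → Set
Edge {n} G = Σ (Fin n × Fin n) λ p → (proj₁ p < proj₂ p) × (adj G (proj₁ p) (proj₂ p) ≡ true)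

numEdges : ∀ {n} → Graph n → ℕ
numEdges {n} G =
  length (filter (λ p → (proj₁ p <? proj₂ p) ×-dec (adj G (proj₁ p) (proj₂ p) ≟B true))
                 (cartesianProduct (allFin n) (allFin n)))

SameEdge : ∀ {n} {G : Graph n} → Edge G → Edge G → Set
SameEdge e e' = proj₁ e ≡ proj₁ e'

Disjoint : ∀ {n} {G : Graph n} → Edge G → Edge G → Set
Disjoint ((a , b) , _) ((c , d) , _) = (a ≢ c) × (a ≢ d) × (b ≢ c) × (b ≢ d)

F1 : ∀ {n} → Graph n → Set
F1 G = Σ (Edge G → Edge G) λ f → ∀ e → ¬ SameEdge {G = G} (f e) e

Matching : ∀ {n} → Graph n → ℕ → Set
Matching G t = Σ (Fin t → Edge G) λ M → ∀ i j → i ≢ j → Disjoint {G = G} (M i) (M j)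

FFree : ∀ {n} {G : Graph n} {t} → (Edge G → Edge G) → Matching G t → Set
FFree {G = G} f (M , _) = ∀ i j → ¬ SameEdge {G = G} (f (M i)) (M j)

HGood : ∀ {n} → Graph n → ℕ → Set
HGood G t = Σ (F1 G) λ f → ¬ (Σ (Matching G t) λ M → FFree {G = G} (proj₁ f) M)

TKFree : ∀ {n} → Graph n → ℕ → Set
TKFree G t = ¬ Matching G t

IsMaxEdges : (n : ℕ) → (Graph n → Set) → ℕ → Set
IsMaxEdges n P m = (∃ λ (G : Graph n) → P G × numEdges G ≡ m)
                 × (∀ (G : Graph n) → P G → numEdges G ≤ m)

IsH : ℕ → ℕ → ℕ → Set
IsH n t m = IsMaxEdges n (λ G → HGood G t) m

IsEx : ℕ → ℕ → ℕ → Set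
IsEx n t m = IsMaxEdges n (λ G → TKFree G t) m

{-# OPTIONS --safe #-}

-- Call two edges compatible if they are disjoint and neither is the f-image of the other; an f-free tK₂ is a set
-- of t pairwise compatible edges. The map f enters through one remark: an edge y with f y = x cannot also satisfy
-- f y = x', so for x ≠ x' only few y are incompatible with both. Hence, given sufficiently long lists of edges,
-- compatible representatives can be chosen one after another: each later list rules out at most one candidate of
-- the current list.
--
-- Upper bound for large n. Let A be the set of vertices of high degree. If |A| ≥ t, choose representatives of t
-- stars. If |A| = t - 1 and at least t edges avoid A, choose one of these t edges and then edges of the t - 1 stars;
-- for ex(n, tK₂), where f is absent, one edge avoiding A is enough. If |A| ≤ t - 2, the edges avoiding A have bounded
-- degrees, so either they contain t compatible edges or their number is bounded and n is too large.
-- The bounds are attained by t - 1 dominating vertices, with f sending the edges at the i-th dominating vertex to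
-- the i-th of t - 1 further edges.
--
-- Upper bound for t = 2. Suppose that at least max (8, n + 1) edges have no compatible pair. A vertex of degree ≥ 6
-- and two edges avoiding it, or a vertex of degree 5 and three edges avoiding it, have too many disjoint pairs for
-- f to cover. With degree 4 and four edges avoiding the vertex v the count is tight, which forces these four edges
-- to be pairwise intersecting and to lie on the four neighbours of v; but two of them belong to the same perfect
-- matching of K₄. If all degrees are at most 3, every edge has at least two preimages under f, which is one
-- too many on average.
module Submission where

open import Defs
open import Axiom.UniquenessOfIdentityProofs using (module Decidable⇒UIP)
open import Data.Bool using (Bool; true; false; _∧_; _∨_; if_then_else_) renaming (T to IsTrue)
import Data.Bool.Properties as Bool
open import Data.Fin as Fin using (Fin; zero; suc; toℕ; fromℕ<)
open import Data.Fin.Patterns using (0F; 1F; 2F; 3F; 4F)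
import Data.Fin.Properties as Fin
open import Data.List using (List; []; _∷_; length; filter; map; lookup; _++_; allFin; cartesianProduct; take; replicate; tabulate)
open import Data.List.Properties using (filter-++; filter-notAll; length-++; length-map; length-replicate; length-take; map-tabulate)
open import Data.List.Membership.Propositional using (_∈_; lose)
open import Data.List.Membership.Propositional.Properties using (∈-allFin; ∈-filter⁺; ∈-filter⁻; ∈-lookup; ∈-map⁻)
open import Data.List.Relation.Binary.Pointwise using (Pointwise; []; _∷_; Pointwise-length)
open import Data.List.Relation.Unary.All as All using (All; []; _∷_)
import Data.List.Relation.Unary.All.Properties as All
open import Data.List.Relation.Unary.AllPairs as AllPairs using (AllPairs; []; _∷_)
import Data.List.Relation.Unary.AllPairs.Properties as AllPairs
open import Data.List.Relation.Unary.Any as Any using (Any; here; there)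
open import Data.List.Relation.Unary.Any.Properties using (lookup-index)
open import Data.List.Relation.Unary.Unique.Propositional using (Unique)
import Data.List.Relation.Unary.Unique.Propositional.Properties as Unique
open import Data.Maybe using (Maybe; just; nothing)
open import Data.Maybe.Properties using (just-injective) renaming (≡-dec to maybe-≡-dec)
open import Data.Nat as ℕ using (ℕ; zero; suc; _+_; _*_; _∸_; _≤_; _<_; z≤n; s≤s; _≤?_; _<ᵇ_)
open import Data.Nat.Combinatorics using (_C_; nCk+nC[k+1]≡[n+1]C[k+1]; nC1≡n)
open import Data.Nat.ListAction using (sum)
open import Data.Nat.Properties
import Data.Nat.Solver
open import Data.Product using (Σ; ∃; _×_; _,_; proj₁; proj₂)
import Data.Product.Properties as Product
open import Data.Sum using (_⊎_; inj₁; inj₂; [_,_]′)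
open import Function using (_∘_; id)
open import Relation.Binary.Definitions using (DecidableEquality; tri<; tri≈; tri>)
open import Relation.Binary.PropositionalEquality hiding (sym)
import Relation.Binary.PropositionalEquality as ≡
open import Relation.Nullary using (¬_; Dec; yes; no; does; contradiction)
open import Relation.Nullary.Decidable using (¬?; _×-dec_; _⊎-dec_; _→-dec_; dec-true; dec-false; decidable-stable; map′; toWitness)
open import Relation.Unary using (Decidable)

private variable
  A B : Set
  P Q R : A → Set
  xs : List A

-- Counting in lists

count : {P : A → Set} → Decidable P → List A → ℕ
count P? xs = length (filter P? xs)

numBool : Bool → ℕ
numBool b = if b then 1 else 0

ind : {X : Set} → Dec X → ℕ
ind d = numBool (does d)

count-∷ : (P? : Decidable P) → ∀ x xs → count P? (x ∷ xs) ≡ ind (P? x) + count P? xs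
count-∷ P? x xs with does (P? x)
... | true  = refl
... | false = refl

count-⊎ : (P? : Decidable P) (Q? : Decidable Q) (R? : Decidable R) → ∀ xs →
          (∀ {x} → x ∈ xs → P x → Q x ⊎ R x) → count P? xs ≤ count Q? xs + count R? xs
count-⊎ P? Q? R? [] h = z≤n
count-⊎ P? Q? R? (x ∷ xs) h
  rewrite count-∷ P? x xs | count-∷ Q? x xs | count-∷ R? x xs
  with P? x | Q? x | R? x | count-⊎ P? Q? R? xs (λ x∈ → h (there x∈))
... | no _ | q | r | ih = ≤-trans ih (+-mono-≤ (m≤n+m _ (ind q)) (m≤n+m _ (ind r)))
... | yes p | yes _ | r | ih = s≤s (≤-trans ih (+-monoʳ-≤ (count Q? xs) (m≤n+m _ (ind r))))
... | yes p | no _ | yes _ | ih = ≤-trans (s≤s ih) (≤-reflexive (≡.sym (+-suc _ _)))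
... | yes p | no ¬q | no ¬r | ih with h (here refl) p
... | inj₁ q = contradiction q ¬q
... | inj₂ r = contradiction r ¬r

count-mono : (P? : Decidable P) (Q? : Decidable Q) → ∀ xs →
             (∀ {x} → x ∈ xs → P x → Q x) → count P? xs ≤ count Q? xs
count-mono P? Q? [] h = z≤n
count-mono P? Q? (x ∷ xs) h
  rewrite count-∷ P? x xs | count-∷ Q? x xs
  with P? x | Q? x | count-mono P? Q? xs (λ x∈ → h (there x∈))
... | no _ | q | ih = ≤-trans ih (m≤n+m _ (ind q))
... | yes _ | yes _ | ih = s≤s ih
... | yes p | no ¬q | ih = contradiction (h (here refl) p) ¬q

count-compl : (P? : Decidable P) → ∀ xs → count P? xs + count (¬? ∘ P?) xs ≡ length xs
count-compl P? [] = refl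
count-compl P? (x ∷ xs) with P? x
... | yes _ = cong suc (count-compl P? xs)
... | no _  = trans (+-suc _ _) (cong suc (count-compl P? xs))

count-filter : (P? : Decidable P) (Q? : Decidable Q) → ∀ xs → count P? (filter Q? xs) ≤ count P? xs
count-filter P? Q? [] = z≤n
count-filter P? Q? (x ∷ xs) rewrite count-∷ P? x xs with Q? x
... | no _ = ≤-trans (count-filter P? Q? xs) (m≤n+m _ (ind (P? x)))
... | yes _ rewrite count-∷ P? x (filter Q? xs) = +-monoʳ-≤ (ind (P? x)) (count-filter P? Q? xs)

count≤count-filter : (P? : Decidable P) (Q? : Decidable Q) → ∀ xs → (∀ {x} → x ∈ xs → P x → Q x) →
                count P? xs ≤ count P? (filter Q? xs)
count≤count-filter P? Q? [] h = z≤n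
count≤count-filter P? Q? (x ∷ xs) h rewrite count-∷ P? x xs with Q? x
... | yes _ rewrite count-∷ P? x (filter Q? xs) =
  +-monoʳ-≤ (ind (P? x)) (count≤count-filter P? Q? xs (λ x∈ → h (there x∈)))
... | no ¬q with P? x
... | yes p = contradiction (h (here refl) p) ¬q
... | no _ = count≤count-filter P? Q? xs (λ x∈ → h (there x∈))

unique-lookup-injective : Unique xs → ∀ {i j} → lookup xs i ≡ lookup xs j → i ≡ j
unique-lookup-injective (_ ∷ _) {zero} {zero} eq = refl
unique-lookup-injective {xs = x ∷ xs} (x∉ ∷ _) {zero} {suc j} eq = contradiction eq (All.lookup x∉ (∈-lookup j))
unique-lookup-injective {xs = x ∷ xs} (x∉ ∷ _) {suc i} {zero} eq = contradiction (≡.sym eq) (All.lookup x∉ (∈-lookup i))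
unique-lookup-injective (_ ∷ u) {suc i} {suc j} eq = cong suc (unique-lookup-injective u eq)

unique-length : ∀ {n} {xs : List (Fin n)} → Unique xs → length xs ≤ n
unique-length u = Fin.injective⇒≤ (unique-lookup-injective u)

unique-map : {xs : List A} (f : A → B) → (∀ {x y} → x ∈ xs → y ∈ xs → f x ≡ f y → x ≡ y) →
             Unique xs → Unique (map f xs)
unique-map f inj [] = []
unique-map {xs = x ∷ xs} f inj (x∉ ∷ u) = fresh xs (λ y∈ → y∈) ∷ unique-map f (λ x∈ y∈ → inj (there x∈) (there y∈)) u
  where
  fresh : ∀ ys → (∀ {y} → y ∈ ys → y ∈ xs) → All (f x ≢_) (map f ys)
  fresh [] _ = []
  fresh (y ∷ ys) ⊆ = (λ eq → All.lookup x∉ (⊆ (here refl)) (inj (here refl) (there (⊆ (here refl))) eq))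
                     ∷ fresh ys (λ y∈ → ⊆ (there y∈))

AtMostOne : (A → Set) → Set
AtMostOne {A} P = ∀ {x y : A} → P x → P y → x ≡ y

-- Pigeonhole: sending each entry to the index of a predicate that holds for it is injective, as no
-- predicate holds for two different entries. Upper bounds on stars are obtained by listing such
-- predicates.
length≤cover : {xs : List A} (Qs : List (A → Set)) → Unique xs → All AtMostOne Qs →
               (∀ {x} → x ∈ xs → Any (λ Q → Q x) Qs) → length xs ≤ length Qs
length≤cover {xs = xs} Qs u one cov = Fin.injective⇒≤ {f = idx} λ {i} {j} eq →
  unique-lookup-injective u
    (All.lookup one (∈-lookup (idx j))
      (subst (λ k → lookup Qs k (lookup xs i)) eq (lookup-index (cov (∈-lookup i))))
      (lookup-index (cov (∈-lookup j))))
  where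
  idx : Fin (length xs) → Fin (length Qs)
  idx i = Any.index (cov (∈-lookup i))

count≤cover : {P : A → Set} (P? : Decidable P) {xs : List A} (Qs : List (A → Set)) → Unique xs → All AtMostOne Qs →
              (∀ {x} → x ∈ xs → P x → Any (λ Q → Q x) Qs) → count P? xs ≤ length Qs
count≤cover P? Qs u one cov = length≤cover Qs (Unique.filter⁺ P? u) one
  λ x∈ → let x∈xs , px = ∈-filter⁻ P? x∈ in cov x∈xs px

count≤1 : {P : A → Set} (P? : Decidable P) {xs : List A} → Unique xs →
          (∀ {x y} → x ∈ xs → y ∈ xs → P x → P y → x ≡ y) → count P? xs ≤ 1
count≤1 {P = P} P? {xs} u one = count≤cover P? ((λ x → x ∈ xs × P x) ∷ []) u
  ((λ { (x∈ , px) (y∈ , py) → one x∈ y∈ px py }) ∷ []) (λ x∈ px → here (x∈ , px))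

-- Double counting of a relation between two lists

sum-map-+ : (f g : A → ℕ) → ∀ xs → sum (map (λ x → f x + g x) xs) ≡ sum (map f xs) + sum (map g xs)
sum-map-+ f g [] = refl
sum-map-+ f g (x ∷ xs) rewrite sum-map-+ f g xs = begin
  f x + g x + (F + G)   ≡⟨ +-assoc (f x) (g x) (F + G) ⟩
  f x + (g x + (F + G)) ≡⟨ cong (f x +_) (≡.sym (+-assoc (g x) F G)) ⟩
  f x + (g x + F + G)   ≡⟨ cong (λ z → f x + (z + G)) (+-comm (g x) F) ⟩
  f x + (F + g x + G)   ≡⟨ cong (f x +_) (+-assoc F (g x) G) ⟩
  f x + (F + (g x + G)) ≡⟨ ≡.sym (+-assoc (f x) F (g x + G)) ⟩
  f x + F + (g x + G)   ∎
  where
  open ≡-Reasoning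
  F = sum (map f xs)
  G = sum (map g xs)

sum-map-cong : {f g : A → ℕ} → (∀ x → f x ≡ g x) → ∀ xs → sum (map f xs) ≡ sum (map g xs)
sum-map-cong h [] = refl
sum-map-cong h (x ∷ xs) = cong₂ _+_ (h x) (sum-map-cong h xs)

sum-map-0 : ∀ (ys : List A) → sum (map (λ _ → 0) ys) ≡ 0
sum-map-0 [] = refl
sum-map-0 (_ ∷ ys) = sum-map-0 ys

count≡sum : {P : A → Set} (P? : Decidable P) → ∀ xs → count P? xs ≡ sum (map (λ x → ind (P? x)) xs)
count≡sum P? [] = refl
count≡sum P? (x ∷ xs) = trans (count-∷ P? x xs) (cong (ind (P? x) +_) (count≡sum P? xs))

double-count : {R : A → B → Set} (R? : ∀ x y → Dec (R x y)) → ∀ xs ys →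
               sum (map (λ x → count (R? x) ys) xs) ≡ sum (map (λ y → count (λ x → R? x y) xs) ys)
double-count R? [] ys = ≡.sym (sum-map-0 ys)
double-count R? (x ∷ xs) ys = begin
  count (R? x) ys + sum (map (λ x → count (R? x) ys) xs)
    ≡⟨ cong₂ _+_ (count≡sum (R? x) ys) (double-count R? xs ys) ⟩
  sum (map (λ y → ind (R? x y)) ys) + sum (map (λ y → count (λ x → R? x y) xs) ys)
    ≡⟨ ≡.sym (sum-map-+ _ _ ys) ⟩
  sum (map (λ y → ind (R? x y) + count (λ x → R? x y) xs) ys)
    ≡⟨ sum-map-cong (λ y → ≡.sym (count-∷ (λ x → R? x y) x xs)) ys ⟩
  sum (map (λ y → count (λ x → R? x y) (x ∷ xs)) ys) ∎
  where open ≡-Reasoning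

sum-map-≤ : (f : A → ℕ) (b : ℕ) → ∀ xs → (∀ {x} → x ∈ xs → f x ≤ b) → sum (map f xs) ≤ length xs * b
sum-map-≤ f b [] h = z≤n
sum-map-≤ f b (x ∷ xs) h = +-mono-≤ (h (here refl)) (sum-map-≤ f b xs (λ x∈ → h (there x∈)))

sum-map-≥ : (f : A → ℕ) (b : ℕ) → ∀ xs → (∀ {x} → x ∈ xs → b ≤ f x) → length xs * b ≤ sum (map f xs)
sum-map-≥ f b [] h = z≤n
sum-map-≥ f b (x ∷ xs) h = +-mono-≤ (h (here refl)) (sum-map-≥ f b xs (λ x∈ → h (there x∈)))

-- No summand exceeds `b`, so a summand below `b` could not be made up for by the others.
sum-map-tight : (f : A → ℕ) (b : ℕ) → ∀ xs → (∀ {x} → x ∈ xs → f x ≤ b) →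
                length xs * b ≤ sum (map f xs) → ∀ {x} → x ∈ xs → b ≤ f x
sum-map-tight f b (x ∷ xs) h le (here refl) =
  +-cancelʳ-≤ (length xs * b) b (f x) (≤-trans le (+-monoʳ-≤ (f x) (sum-map-≤ f b xs (λ x∈ → h (there x∈)))))
sum-map-tight f b (x ∷ xs) h le (there x∈) = sum-map-tight f b xs (λ x∈ → h (there x∈))
  (+-cancelˡ-≤ b _ _ (≤-trans le (+-monoˡ-≤ (sum (map f xs)) (h (here refl))))) x∈

allPairs-lookup : {R : A → A → Set} → (∀ {x y} → R x y → R y x) → {xs : List A} → AllPairs R xs →
                  ∀ i j → i ≢ j → R (lookup xs i) (lookup xs j)
allPairs-lookup s (_ ∷ _) zero zero ne = contradiction refl ne
allPairs-lookup s (rx ∷ _) zero (suc j) ne = All.lookup rx (∈-lookup j)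
allPairs-lookup s (rx ∷ _) (suc i) zero ne = s (All.lookup rx (∈-lookup i))
allPairs-lookup s (_ ∷ rs) (suc i) (suc j) ne = allPairs-lookup s rs i j (ne ∘ cong suc)

-- Compatible representatives of long lists

-- Made for one round of `choose`: `suc s` candidates in the first list outnumber the `s` later
-- lists, and the remaining summands are the length at which `few-bad` leaves all candidates but one
-- with `threshold c s` elements of a later list.
threshold : ℕ → ℕ → ℕ
threshold c zero = 0
threshold c (suc s) = suc s + (threshold c s + (threshold c s + c))

module Transversal {X : Set} (_≟_ : DecidableEquality X) {_~_ : X → X → Set} (_~?_ : ∀ x y → Dec (x ~ y)) where

  BothFail? : ∀ x x' y → Dec (¬ (x ~ y) × ¬ (x' ~ y))
  BothFail? x x' y = ¬? (x ~? y) ×-dec ¬? (x' ~? y)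

  -- Only pairs can be controlled: a single element may be incompatible with all of `T`, for
  -- instance if `f` maps every edge of `T` to it.
  JointlyFew : ℕ → List X → List X → Set
  JointlyFew c S T = ∀ {x x'} → x ∈ S → x' ∈ S → x ≢ x' → count (BothFail? x x') T ≤ c

  Choice : List (List X) → Set
  Choice Ss = ∃ λ L → Pointwise _∈_ L Ss × AllPairs _~_ L

  split-length : ∀ x x' T → length T ≤ count (x ~?_) T + (count (x' ~?_) T + count (BothFail? x x') T)
  split-length x x' T = begin
    length T
      ≡⟨ ≡.sym (count-compl (x ~?_) T) ⟩
    count (x ~?_) T + count (¬? ∘ (x ~?_)) T
      ≤⟨ +-monoʳ-≤ (count (x ~?_) T) (count-⊎ _ (x' ~?_) (BothFail? x x') T λ {y} _ ¬x~y → split y ¬x~y) ⟩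
    count (x ~?_) T + (count (x' ~?_) T + count (BothFail? x x') T) ∎
    where
    open ≤-Reasoning
    split : ∀ y → ¬ (x ~ y) → x' ~ y ⊎ (¬ (x ~ y) × ¬ (x' ~ y))
    split y ¬x~y with x' ~? y
    ... | yes x'~y = inj₁ x'~y
    ... | no ¬x'~y = inj₂ (¬x~y , ¬x'~y)

  -- If x and x' each left fewer than M candidates in T, then T would be too short.
  few-bad : ∀ {c} M {S T} → Unique S → JointlyFew c S T → M + (M + c) ≤ length T →
            count (λ x → ¬? (M ≤? count (x ~?_) T)) S ≤ 1
  few-bad {c} M {S} {T} u few big = count≤1 _ u λ {x} {x'} x∈ x'∈ bad bad' →
    decidable-stable (x ≟ x') λ x≢x' → <⇒≱
      (<-≤-trans (s≤s (split-length x x' T))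
        (+-mono-<-≤ (≰⇒> bad) (+-mono-≤ (<⇒≤ (≰⇒> bad')) (few x∈ x'∈ x≢x'))))
      big

  -- By `few-bad`, each list in `Ss` disqualifies at most one candidate, so some candidate survives
  -- when there are more candidates than lists.
  pick : ∀ {c} M S Ss → Unique S → length Ss < length S → All (JointlyFew c S) Ss →
         All (λ T → M + (M + c) ≤ length T) Ss →
         ∃ λ x → x ∈ S × All (λ T → M ≤ count (x ~?_) T) Ss
  pick M (x ∷ S) [] _ _ _ _ = x , here refl , []
  pick {c} M S (T ∷ Ss) u lt (few ∷ fews) (big ∷ bigs) =
    let x , x∈ , rest = pick M S' Ss (Unique.filter⁺ good? u) lt' (All.map (λ {T} → restrict {T}) fews) bigs
        x∈S , good = ∈-filter⁻ good? x∈
    in x , x∈S , good ∷ rest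
    where
    good? : ∀ x → Dec (M ≤ count (x ~?_) T)
    good? x = M ≤? count (x ~?_) T
    S' : List X
    S' = filter good? S
    restrict : ∀ {T} → JointlyFew c S T → JointlyFew c S' T
    restrict jf x∈ x'∈ = jf (proj₁ (∈-filter⁻ good? x∈)) (proj₁ (∈-filter⁻ good? x'∈))
    lt' : length Ss < length S'
    lt' = ≤-pred (begin
      suc (suc (length Ss))             ≤⟨ lt ⟩
      length S                          ≡⟨ ≡.sym (count-compl good? S) ⟩
      length S' + count (¬? ∘ good?) S  ≤⟨ +-monoʳ-≤ (length S') (few-bad M {T = T} u few big) ⟩
      length S' + 1                     ≡⟨ +-comm (length S') 1 ⟩
      suc (length S')                   ∎)
      where open ≤-Reasoning

  choice-∷ : ∀ {x S} Ss → x ∈ S → Choice (map (filter (x ~?_)) Ss) → Choice (S ∷ Ss)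
  choice-∷ {x} {S} Ss x∈ (L , L∈ , L~) = let L∈′ , x~L = unfilter L Ss L∈ in x ∷ L , x∈ ∷ L∈′ , x~L ∷ L~
    where
    unfilter : ∀ L Ss → Pointwise _∈_ L (map (filter (x ~?_)) Ss) → Pointwise _∈_ L Ss × All (x ~_) L
    unfilter [] [] [] = [] , []
    unfilter (y ∷ L) (T ∷ Ss) (y∈ ∷ L∈) =
      let y∈T , x~y = ∈-filter⁻ (x ~?_) y∈ ; L∈′ , x~L = unfilter L Ss L∈ in y∈T ∷ L∈′ , x~y ∷ x~L

  few-filter : ∀ {c S T} z → JointlyFew c S T → JointlyFew c (filter (z ~?_) S) (filter (z ~?_) T)
  few-filter {T = T} z jf {x} {x'} x∈ x'∈ x≢x' =
    ≤-trans (count-filter (BothFail? x x') (z ~?_) T)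
      (jf (proj₁ (∈-filter⁻ (z ~?_) x∈)) (proj₁ (∈-filter⁻ (z ~?_) x'∈)) x≢x')

  -- Separated from `choose` because the first representative is sometimes found differently: the
  -- list of edges avoiding `A` may be too short for `choose`.
  extend : ∀ {c} s {S x} Ss → x ∈ S → length Ss ≡ s → All Unique Ss → AllPairs (JointlyFew c) Ss →
           All (λ T → threshold c s ≤ count (x ~?_) T) Ss → Choice (S ∷ Ss)

  choose : ∀ {c} s Ss → length Ss ≡ s → All Unique Ss → AllPairs (JointlyFew c) Ss →
           All (λ S → threshold c s ≤ length S) Ss → Choice Ss

  extend s {x = x} Ss x∈ len us fews rest = choice-∷ Ss x∈ (choose s (map (filter (x ~?_)) Ss)
    (trans (length-map _ Ss) len)
    (All.map⁺ (All.map (Unique.filter⁺ (x ~?_)) us))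
    (AllPairs.map⁺ (AllPairs.map (λ {S} {T} → few-filter {S = S} {T} x) fews))
    (All.map⁺ rest))

  choose zero [] _ _ _ _ = [] , [] , []
  choose {c} (suc s) (S ∷ Ss) len (u ∷ us) (few ∷ fews) (big ∷ bigs) =
    let len′ = suc-injective len
        x , x∈ , rest = pick (threshold c s) S Ss u
          (≤-trans (≤-reflexive len) (≤-trans (m≤m+n (suc s) _) big))
          few (All.map (≤-trans (m≤n+m _ (suc s))) bigs)
    in extend s Ss x∈ len′ us fews rest

-- Edges and degrees of a graph

attach : {A : Set} {P : A → Set} {xs : List A} → All P xs → List (Σ A P)
attach [] = []
attach (_∷_ {x = x} px pxs) = (x , px) ∷ attach pxs

map-proj₁-attach : {A : Set} {P : A → Set} {xs : List A} (pxs : All P xs) → map proj₁ (attach pxs) ≡ xs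
map-proj₁-attach [] = refl
map-proj₁-attach (px ∷ pxs) = cong (_ ∷_) (map-proj₁-attach pxs)

-- The number of edges of the complete graph on n vertices that meet k given vertices.
touching : ℕ → ℕ → ℕ
touching n zero = 0
touching n (suc k) = (n ∸ suc k) + touching n k

C2-suc : ∀ k → suc k C 2 ≡ k + k C 2
C2-suc k = trans (≡.sym (nCk+nC[k+1]≡[n+1]C[k+1] k 1)) (cong (_+ k C 2) (nC1≡n k))

-- Writing the order as `k + m` resolves the truncated subtraction; the induction reads `suc k + m`
-- as `k + suc m`.
touching-formula : ∀ k m → touching (k + m) k ≡ k * m + k C 2
touching-formula zero m = refl
touching-formula (suc k) m = begin
  (k + m ∸ k) + touching (suc k + m) k    ≡⟨ cong₂ (λ x y → x + touching y k) (m+n∸m≡n k m) (≡.sym (+-suc k m)) ⟩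
  m + touching (k + suc m) k              ≡⟨ cong (m +_) (touching-formula k (suc m)) ⟩
  m + (k * suc m + k C 2)                 ≡⟨ cong (λ z → m + (z + k C 2)) (*-suc k m) ⟩
  m + (k + k * m + k C 2)                 ≡⟨ solve 4 (λ m k x c → m :+ (k :+ x :+ c) := m :+ x :+ (k :+ c)) refl m k (k * m) (k C 2) ⟩
  m + k * m + (k + k C 2)                 ≡⟨ cong (m + k * m +_) (≡.sym (C2-suc k)) ⟩
  suc k * m + suc k C 2                   ∎
  where
  open ≡-Reasoning
  open Data.Nat.Solver.+-*-Solver

IsEdge : ∀ {n} → Graph n → Fin n × Fin n → Set
IsEdge G p = (proj₁ p Fin.< proj₂ p) × (adj G (proj₁ p) (proj₂ p) ≡ true)

isEdge? : ∀ {n} (G : Graph n) p → Dec (IsEdge G p)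
isEdge? G p = (proj₁ p Fin.<? proj₂ p) ×-dec (adj G (proj₁ p) (proj₂ p) Bool.≟ true)

module EdgeLists {n : ℕ} (G : Graph n) where

  end₁ end₂ : Edge G → Fin n
  end₁ e = proj₁ (proj₁ e)
  end₂ e = proj₂ (proj₁ e)

  ends< : ∀ e → end₁ e Fin.< end₂ e
  ends< e = proj₁ (proj₂ e)

  edge-≡ : ∀ {e e' : Edge G} → proj₁ e ≡ proj₁ e' → e ≡ e'
  edge-≡ {p , lt , a} {.p , lt' , a'} refl =
    cong (p ,_) (cong₂ _,_ (≤-irrelevant lt lt') (Decidable⇒UIP.≡-irrelevant Bool._≟_ a a'))

  _≟ᴱ_ : DecidableEquality (Edge G)
  e ≟ᴱ e' = map′ edge-≡ (cong proj₁) (Product.≡-dec Fin._≟_ Fin._≟_ (proj₁ e) (proj₁ e'))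

  Inc : Fin n → Edge G → Set
  Inc v e = v ≡ end₁ e ⊎ v ≡ end₂ e

  inc? : ∀ v e → Dec (Inc v e)
  inc? v e = (v Fin.≟ end₁ e) ⊎-dec (v Fin.≟ end₂ e)

  edge-determined : ∀ {a b e e'} → a ≢ b → Inc a e → Inc b e → Inc a e' → Inc b e' → e ≡ e'
  edge-determined a≢b (inj₁ refl) (inj₁ refl) _ _ = contradiction refl a≢b
  edge-determined a≢b (inj₂ refl) (inj₂ refl) _ _ = contradiction refl a≢b
  edge-determined a≢b _ _ (inj₁ refl) (inj₁ refl) = contradiction refl a≢b
  edge-determined a≢b _ _ (inj₂ refl) (inj₂ refl) = contradiction refl a≢b
  edge-determined a≢b (inj₁ p) (inj₂ q) (inj₁ p') (inj₂ q') =
    edge-≡ (cong₂ _,_ (trans (≡.sym p) p') (trans (≡.sym q) q'))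
  edge-determined a≢b (inj₂ p) (inj₁ q) (inj₂ p') (inj₁ q') =
    edge-≡ (cong₂ _,_ (trans (≡.sym q) q') (trans (≡.sym p) p'))
  -- In the last two cases the edges would list `a` and `b` in opposite orders, but both lists are
  -- increasing.
  edge-determined {e = e} {e'} a≢b (inj₁ refl) (inj₂ refl) (inj₂ p) (inj₁ q) =
    contradiction (ends< e') (<-asym (subst₂ Fin._<_ p q (ends< e)))
  edge-determined {e = e} {e'} a≢b (inj₂ refl) (inj₁ refl) (inj₁ p) (inj₂ q) =
    contradiction (ends< e') (<-asym (subst₂ Fin._<_ q p (ends< e)))

  _⊥_ : Edge G → Edge G → Set
  e ⊥ e' = Disjoint {G = G} e e'

  _⊥?_ : ∀ e e' → Dec (e ⊥ e')
  e ⊥? e' = ¬? (end₁ e Fin.≟ end₁ e') ×-dec ¬? (end₁ e Fin.≟ end₂ e')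
    ×-dec ¬? (end₂ e Fin.≟ end₁ e') ×-dec ¬? (end₂ e Fin.≟ end₂ e')

  ⊥-sym : ∀ {e e'} → e ⊥ e' → e' ⊥ e
  ⊥-sym (p , q , r , s) = p ∘ ≡.sym , r ∘ ≡.sym , q ∘ ≡.sym , s ∘ ≡.sym

  ⊥⇒¬inc : ∀ {v e e'} → e ⊥ e' → Inc v e → ¬ Inc v e'
  ⊥⇒¬inc (p , q , r , s) (inj₁ refl) (inj₁ x) = p x
  ⊥⇒¬inc (p , q , r , s) (inj₁ refl) (inj₂ x) = q x
  ⊥⇒¬inc (p , q , r , s) (inj₂ refl) (inj₁ x) = r x
  ⊥⇒¬inc (p , q , r , s) (inj₂ refl) (inj₂ x) = s x

  meets-at-end : ∀ e e' → ¬ (e ⊥ e') → Inc (end₁ e) e' ⊎ Inc (end₂ e) e'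
  meets-at-end e e' ¬⊥ with inc? (end₁ e) e' | inc? (end₂ e) e'
  ... | yes p | _ = inj₁ p
  ... | no _ | yes q = inj₂ q
  ... | no p | no q = contradiction (p ∘ inj₁ , p ∘ inj₂ , q ∘ inj₁ , q ∘ inj₂) ¬⊥

  private
    edgesAll : All _ (filter (isEdge? G) (cartesianProduct (allFin n) (allFin n)))
    edgesAll = All.all-filter (isEdge? G) (cartesianProduct (allFin n) (allFin n))

  -- Built from the very list that `numEdges` measures, so that the two counts agree.
  edges : List (Edge G)
  edges = attach edgesAll

  edges-unique : Unique edges
  edges-unique = Unique.map⁻ {f = proj₁} (subst Unique (≡.sym (map-proj₁-attach edgesAll))
    (Unique.filter⁺ (isEdge? G) (Unique.cartesianProduct⁺ (Unique.allFin⁺ n) (Unique.allFin⁺ n))))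

  length-edges : length edges ≡ numEdges G
  length-edges = trans (≡.sym (length-map proj₁ edges)) (cong length (map-proj₁-attach edgesAll))

  deg : Fin n → ℕ
  deg v = count (inc? v) edges

  other : Fin n → Edge G → Fin n
  other v e with v Fin.≟ end₁ e
  ... | yes _ = end₂ e
  ... | no _ = end₁ e

  other-inc : ∀ v e → Inc (other v e) e
  other-inc v e with v Fin.≟ end₁ e
  ... | yes _ = inj₂ refl
  ... | no _ = inj₁ refl

  other-≢ : ∀ v e → v ≢ other v e
  other-≢ v e with v Fin.≟ end₁ e
  ... | yes refl = λ eq → <⇒≢ (ends< e) (cong Fin.toℕ eq)
  ... | no ne = ne

  Touch : List (Fin n) → Edge G → Set
  Touch B e = Any (λ b → Inc b e) B

  touch? : ∀ B e → Dec (Touch B e)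
  touch? B e = Any.any? (λ b → inc? b e) B

  -- The far ends of the edges in `S`, the vertex `v` and the vertices of `B` are pairwise distinct.
  star-bound : ∀ {v B} → Unique (v ∷ B) → {S : List (Edge G)} → Unique S →
               (∀ {e} → e ∈ S → Inc v e) → (∀ {e} → e ∈ S → ¬ Touch B e) → length S + suc (length B) ≤ n
  star-bound {v} {B} uB {S} uS inc avoid = begin
    length S + suc (length B)                ≡⟨ cong (_+ suc (length B)) (≡.sym (length-map (other v) S)) ⟩
    length (map (other v) S) + suc (length B) ≡⟨ ≡.sym (length-++ (map (other v) S)) ⟩
    length (map (other v) S ++ v ∷ B)        ≤⟨ unique-length (Unique.++⁺ uniq uB disj) ⟩
    n                                        ∎
    where
    open ≤-Reasoning
    uniq : Unique (map (other v) S)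
    uniq = unique-map (other v) (λ {x} {y} x∈ y∈ eq → edge-determined (other-≢ v x) (inc x∈) (other-inc v x)
             (inc y∈) (subst (λ w → Inc w y) (≡.sym eq) (other-inc v y))) uS
    disj : ∀ {w} → ¬ (w ∈ map (other v) S × w ∈ v ∷ B)
    disj (w∈ , w∈′) with ∈-map⁻ (other v) w∈
    disj (w∈ , here refl) | e , e∈ , eq = other-≢ v e eq
    disj (w∈ , there w∈B) | e , e∈ , refl = avoid e∈ (Any.map (λ { refl → other-inc v e }) w∈B)

  star-avoiding? : ∀ v B e → Dec (Inc v e × ¬ Touch B e)
  star-avoiding? v B e = inc? v e ×-dec ¬? (touch? B e)

  star-avoiding-bound : ∀ v B → Unique (v ∷ B) → count (star-avoiding? v B) edges + suc (length B) ≤ n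
  star-avoiding-bound v B uB = star-bound uB (Unique.filter⁺ (star-avoiding? v B) edges-unique)
    (λ e∈ → proj₁ (proj₂ (∈-filter⁻ (star-avoiding? v B) {xs = edges} e∈)))
    (λ e∈ → proj₂ (proj₂ (∈-filter⁻ (star-avoiding? v B) {xs = edges} e∈)))

  deg<n : ∀ v → deg v < n
  deg<n v = ≤-trans (≤-reflexive (+-comm 1 (deg v)))
    (star-bound ([] ∷ []) (Unique.filter⁺ (inc? v) edges-unique)
      (λ e∈ → proj₂ (∈-filter⁻ (inc? v) {xs = edges} e∈)) (λ _ ()))

  -- Each edge is charged to the last vertex of the list that it meets; `a` is then charged only
  -- with edges to vertices outside `a ∷ A`.
  touch-bound : ∀ A → Unique A → count (touch? A) edges ≤ touching n (length A)
  touch-bound [] _ = ≤-trans (count≤cover (touch? []) {edges} [] edges-unique [] (λ _ ())) z≤n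
  touch-bound (a ∷ A) u@(_ ∷ uA) = ≤-trans
    (count-⊎ (touch? (a ∷ A)) (star-avoiding? a A) (touch? A) edges split)
    (+-mono-≤ (m+n≤o⇒m≤o∸n (count (star-avoiding? a A) edges) (star-avoiding-bound a A u)) (touch-bound A uA))
    where
    split : ∀ {e} → e ∈ edges → Touch (a ∷ A) e → (Inc a e × ¬ Touch A e) ⊎ Touch A e
    split {e} _ t with touch? A e
    split {e} _ t | yes q = inj₂ q
    split {e} _ (here p) | no q = inj₁ (p , q)
    split {e} _ (there p) | no q = inj₂ p

-- Upper bounds for large n

-- An edge `x` blocks its image under `f` and at most `b` edges at each of its two ends;
-- `jointBound` allows this for two edges.
hitBound jointBound : ℕ → ℕ
hitBound b = 1 + (b + b)
jointBound b = hitBound b + hitBound b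

-- The summand `t` pays for the edges to later vertices of the list, which a star omits.
-- `lowThreshold` is the length needed for a choice among edges whose ends have degree at most
-- `highDegree t`.
highDegree lowThreshold : ℕ → ℕ
highDegree t = threshold (jointBound 1) t + t
lowThreshold t = threshold (jointBound (highDegree t)) t

touching-mono : ∀ n {k s} → k ≤ s → touching n k ≤ touching n s
touching-mono n {k} {s} k≤s = go (≤⇒≤′ k≤s)
  where
  go : ∀ {s} → k ℕ.≤′ s → touching n k ≤ touching n s
  go ℕ.≤′-refl = ≤-refl
  go (ℕ.≤′-step p) = ≤-trans (go p) (m≤n+m _ _)

-- The last of the `s` vertices alone contributes `n ∸ s` edges, at least `K`. Thus a missing vertex
-- of high degree outweighs a bounded number of edges elsewhere.
touching-gap : ∀ {n s k K} → K + s ≤ n → k < s → touching n k + K ≤ touching n s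
touching-gap {n} {suc s} {k} {K} n-big (s≤s k≤s) = begin
  touching n k + K           ≡⟨ +-comm _ K ⟩
  K + touching n k           ≤⟨ +-mono-≤ (m+n≤o⇒m≤o∸n K n-big) (touching-mono n k≤s) ⟩
  touching n (suc s)         ∎
  where open ≤-Reasoning

-- f is partial so that the constant map nothing covers the Turán number.
module Compatible {n : ℕ} (G : Graph n) (f : Edge G → Maybe (Edge G)) where
  open EdgeLists G

  _~_ : Edge G → Edge G → Set
  e ~ e' = e ⊥ e' × f e ≢ just e' × f e' ≢ just e

  _~?_ : ∀ e e' → Dec (e ~ e')
  e ~? e' = (e ⊥? e') ×-dec ¬? (maybe-≡-dec _≟ᴱ_ (f e) (just e')) ×-dec ¬? (maybe-≡-dec _≟ᴱ_ (f e') (just e))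

  ~-sym : ∀ {e e'} → e ~ e' → e' ~ e
  ~-sym {e} {e'} (d , p , q) = ⊥-sym {e} {e'} d , q , p

  open Transversal _≟ᴱ_ _~?_

  -- The ways in which `x` itself blocks `y`. The remaining one, `f y ≡ just x`, is kept apart
  -- because it holds for at most one `x`.
  Hit : Edge G → Edge G → Set
  Hit x y = f x ≡ just y ⊎ Inc (end₁ x) y ⊎ Inc (end₂ x) y

  hit? : ∀ x y → Dec (Hit x y)
  hit? x y = maybe-≡-dec _≟ᴱ_ (f x) (just y) ⊎-dec inc? (end₁ x) y ⊎-dec inc? (end₂ x) y

  ≁⇒hit : ∀ x y → ¬ (x ~ y) → Hit x y ⊎ f y ≡ just x
  ≁⇒hit x y ¬x~y with x ⊥? y | maybe-≡-dec _≟ᴱ_ (f x) (just y) | maybe-≡-dec _≟ᴱ_ (f y) (just x)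
  ... | no ¬⊥ | _ | _ = inj₁ (inj₂ (meets-at-end x y ¬⊥))
  ... | yes _ | yes p | _ = inj₁ (inj₁ p)
  ... | yes _ | no _ | yes q = inj₂ q
  ... | yes d | no p | no q = contradiction (d , p , q) ¬x~y

  count-hit : ∀ b x T → Unique T → (∀ {u} → Inc u x → count (inc? u) T ≤ b) → count (hit? x) T ≤ hitBound b
  count-hit b x T uT h = begin
    count (hit? x) T
      ≤⟨ count-⊎ (hit? x) target? meets? T (λ _ p → p) ⟩
    count target? T + count meets? T
      ≤⟨ +-mono-≤ (count≤1 target? uT (λ _ _ p q → just-injective (trans (≡.sym p) q)))
                  (count-⊎ meets? (inc? (end₁ x)) (inc? (end₂ x)) T (λ _ p → p)) ⟩
    1 + (count (inc? (end₁ x)) T + count (inc? (end₂ x)) T)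
      ≤⟨ s≤s (+-mono-≤ (h (inj₁ refl)) (h (inj₂ refl))) ⟩
    1 + (b + b) ∎
    where
    open ≤-Reasoning
    target? : ∀ y → Dec (f x ≡ just y)
    target? y = maybe-≡-dec _≟ᴱ_ (f x) (just y)
    meets? : ∀ y → Dec (Inc (end₁ x) y ⊎ Inc (end₂ x) y)
    meets? y = inc? (end₁ x) y ⊎-dec inc? (end₂ x) y

  -- An edge `y` that fails with both `x` and `x'` is hit by one of them, since otherwise `f y`
  -- would equal both.
  jointlyFew : ∀ b S T → Unique T → (∀ {x u} → x ∈ S → Inc u x → count (inc? u) T ≤ b) →
               JointlyFew (jointBound b) S T
  jointlyFew b S T uT h {x} {x'} x∈ x'∈ x≢x' = ≤-trans
    (count-⊎ (BothFail? x x') (hit? x) (hit? x') T λ {y} _ fails → oneHit y fails)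
    (+-mono-≤ (count-hit b x T uT (h x∈)) (count-hit b x' T uT (h x'∈)))
    where
    oneHit : ∀ y → ¬ (x ~ y) × ¬ (x' ~ y) → Hit x y ⊎ Hit x' y
    oneHit y (p , q) with ≁⇒hit x y p | ≁⇒hit x' y q
    ... | inj₁ hx | _ = inj₁ hx
    ... | inj₂ _ | inj₁ hx' = inj₂ hx'
    ... | inj₂ fy | inj₂ fy' = contradiction (just-injective (trans (≡.sym fy) fy')) x≢x'

  count-inc-star : ∀ {a u T} → Unique T → (∀ {y} → y ∈ T → Inc a y) → a ≢ u → count (inc? u) T ≤ 1
  count-inc-star {u = u} uT star a≢u =
    count≤1 (inc? u) uT λ x∈ y∈ p q → edge-determined a≢u (star x∈) p (star y∈) q

  -- Stars at given vertices

  star : Fin n → List (Fin n) → List (Edge G)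
  star a A = filter (star-avoiding? a A) edges

  star-inc : ∀ {a A y} → y ∈ star a A → Inc a y
  star-inc {a} {A} y∈ = proj₁ (proj₂ (∈-filter⁻ (star-avoiding? a A) {xs = edges} y∈))

  star-unique : ∀ a A → Unique (star a A)
  star-unique a A = Unique.filter⁺ (star-avoiding? a A) edges-unique

  -- Each star avoids the later centres, so an edge of an earlier star meets a later star in at most
  -- one edge at each end.
  stars : List (Fin n) → List (List (Edge G))
  stars [] = []
  stars (a ∷ A) = star a A ∷ stars A

  length-stars : ∀ A → length (stars A) ≡ length A
  length-stars [] = refl
  length-stars (a ∷ A) = cong suc (length-stars A)

  stars-unique : ∀ A → All Unique (stars A)
  stars-unique [] = []
  stars-unique (a ∷ A) = star-unique a A ∷ stars-unique A

  count-inc-avoiding : ∀ {a A x u} → ¬ Inc a x → Inc u x → count (inc? u) (star a A) ≤ 1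
  count-inc-avoiding {a} {A} ¬a u∈x = count-inc-star (star-unique a A) star-inc λ { refl → ¬a u∈x }

  stars-few : ∀ S A → (∀ {x} → x ∈ S → ¬ Touch A x) → All (JointlyFew (jointBound 1) S) (stars A)
  stars-few S [] avoid = []
  stars-few S (a ∷ A) avoid =
    (λ {x} {x'} → jointlyFew 1 S (star a A) (star-unique a A)
      (λ {y} y∈ → count-inc-avoiding {x = y} (avoid y∈ ∘ here)) {x} {x'})
    ∷ stars-few S A (λ x∈ → avoid x∈ ∘ there)

  stars-pairwise-few : ∀ A → AllPairs (JointlyFew (jointBound 1)) (stars A)
  stars-pairwise-few [] = []
  stars-pairwise-few (a ∷ A) =
    stars-few (star a A) A (λ x∈ → proj₂ (proj₂ (∈-filter⁻ (star-avoiding? a A) {xs = edges} x∈)))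
    ∷ stars-pairwise-few A

  -- An edge at `a` outside the star joins `a` to a vertex of `A`, and each vertex of `A` accounts
  -- for at most one such edge.
  deg≤star : ∀ {a A} → Unique (a ∷ A) → deg a ≤ length (star a A) + length A
  deg≤star {a} {A} (a∉ ∷ _) = ≤-trans
    (count-⊎ (inc? a) (star-avoiding? a A) touching? edges split)
    (+-monoʳ-≤ _ (≤-trans (count≤cover touching? Qs edges-unique (one A a∉) cover) (≤-reflexive (length-map _ A))))
    where
    touching? : ∀ e → Dec (Inc a e × Touch A e)
    touching? e = inc? a e ×-dec touch? A e
    split : ∀ {e} → e ∈ edges → Inc a e → (Inc a e × ¬ Touch A e) ⊎ (Inc a e × Touch A e)
    split {e} _ p with touch? A e
    ... | yes q = inj₂ (p , q)
    ... | no q = inj₁ (p , q)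
    Qs : List (Edge G → Set)
    Qs = map (λ b e → Inc a e × Inc b e) A
    one : ∀ B → All (a ≢_) B → All AtMostOne (map (λ b e → Inc a e × Inc b e) B)
    one [] [] = []
    one (b ∷ B) (a≢b ∷ a∉) = (λ { (p , q) (p' , q') → edge-determined a≢b p q p' q' }) ∷ one B a∉
    cover : ∀ {e} → e ∈ edges → Inc a e × Touch A e → Any (λ Q → Q e) Qs
    cover {e} _ (p , t) = go A t
      where
      go : ∀ B → Touch B e → Any (λ Q → Q e) (map (λ b e → Inc a e × Inc b e) B)
      go (b ∷ B) (here q) = here (p , q)
      go (b ∷ B) (there t) = there (go B t)

  stars-long : ∀ {N k} A → Unique A → length A ≤ k → All (λ a → N + k ≤ deg a) A → All (λ S → N ≤ length S) (stars A)
  stars-long [] _ _ _ = []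
  stars-long {N} {k} (a ∷ A) u@(_ ∷ uA) len (d ∷ ds) =
    +-cancelʳ-≤ k N (length (star a A)) (≤-trans d (≤-trans (deg≤star u) (+-monoʳ-≤ _ (≤-trans (n≤1+n _) len))))
    ∷ stars-long A uA (≤-trans (n≤1+n _) len) ds

  -- Compatible sets from vertices of high and low degree

  CompatibleSet : ℕ → Set
  CompatibleSet t = ∃ λ L → length L ≡ t × AllPairs _~_ L

  choice⇒set : ∀ {t Ss} → length Ss ≡ t → Choice Ss → CompatibleSet t
  choice⇒set len (L , L∈ , L~) = L , trans (Pointwise-length L∈) len , L~

  HighSet : ℕ → ℕ → Set
  HighSet t s = ∃ λ A → Unique A × length A ≡ s × All (λ a → highDegree t ≤ deg a) A

  outside : List (Fin n) → List (Edge G)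
  outside A = filter (λ e → ¬? (touch? A e)) edges

  outside-avoids : ∀ {A e} → e ∈ outside A → ¬ Touch A e
  outside-avoids {A} e∈ = proj₂ (∈-filter⁻ (λ e → ¬? (touch? A e)) {xs = edges} e∈)

  outside-unique : ∀ A → Unique (outside A)
  outside-unique A = Unique.filter⁺ (λ e → ¬? (touch? A e)) edges-unique

  numEdges≤ : ∀ {A r} → Unique A → length (outside A) ≤ r → numEdges G ≤ touching n (length A) + r
  numEdges≤ {A} {r} uA le = begin
    numEdges G                                    ≡⟨ ≡.sym length-edges ⟩
    length edges                                  ≡⟨ ≡.sym (count-compl (touch? A) edges) ⟩
    count (touch? A) edges + length (outside A)   ≤⟨ +-mono-≤ (touch-bound A uA) le ⟩
    touching n (length A) + r                     ∎
    where open ≤-Reasoning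

  highs⇒set : ∀ {t} → HighSet t t → CompatibleSet t
  highs⇒set {t} (A , uA , len , high) = choice⇒set (trans (length-stars A) len)
    (choose t (stars A) (trans (length-stars A) len) (stars-unique A) (stars-pairwise-few A)
      (stars-long A uA (≤-reflexive len) high))

  -- Representatives are chosen from `t` copies of `H`; compatible edges are disjoint, so none is
  -- chosen twice.
  lows⇒set : ∀ t H → Unique H → (∀ {x u} → x ∈ H → Inc u x → count (inc? u) H ≤ highDegree t) →
             lowThreshold t ≤ length H → CompatibleSet t
  lows⇒set t H uH low long = choice⇒set (length-replicate t)
    (choose t (replicate t H) (length-replicate t) (All.replicate⁺ t uH) (pairwise t) (All.replicate⁺ t long))
    where
    few : JointlyFew (jointBound (highDegree t)) H H
    few {x} {x'} = jointlyFew (highDegree t) H H uH low {x} {x'}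
    pairwise : ∀ k → AllPairs (JointlyFew (jointBound (highDegree t))) (replicate k H)
    pairwise zero = []
    pairwise (suc k) = All.replicate⁺ k few ∷ pairwise k

  high? : ∀ t v → Dec (highDegree t ≤ deg v)
  high? t v = highDegree t ≤? deg v

  highs : ℕ → List (Fin n)
  highs t = filter (high? t) (allFin n)

  highs-unique : ∀ t → Unique (highs t)
  highs-unique t = Unique.filter⁺ (high? t) (Unique.allFin⁺ n)

  highs-high : ∀ t → All (λ a → highDegree t ≤ deg a) (highs t)
  highs-high t = All.all-filter (high? t) (allFin n)

  ¬touch⇒low : ∀ t {e u} → ¬ Touch (highs t) e → Inc u e → deg u ≤ highDegree t
  ¬touch⇒low t {e} {u} ¬touch u∈e with high? t u
  ... | no ¬high = <⇒≤ (≰⇒> ¬high)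
  ... | yes high = contradiction
    (Any.map (λ { refl → u∈e }) (∈-filter⁺ (high? t) (∈-allFin u) high)) ¬touch

  -- More than `s` vertices of high degree give a compatible set through their stars. With fewer,
  -- either the edges avoiding them contain such a set or `touching-gap` absorbs them. Exactly `s`
  -- is left open, as only there do the bounds with and without `f` differ.
  dichotomy : ∀ s → lowThreshold (suc s) + s ≤ n →
              CompatibleSet (suc s) ⊎ numEdges G ≤ touching n s ⊎ HighSet (suc s) s
  dichotomy s n-big with <-cmp (length (highs (suc s))) s
  ... | tri≈ _ len _ = inj₂ (inj₂ (highs (suc s) , highs-unique (suc s) , len , highs-high (suc s)))
  ... | tri> _ _ s<len = inj₁ (highs⇒set
    ( take (suc s) (highs (suc s)) , Unique.take⁺ (suc s) (highs-unique (suc s))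
    , trans (length-take (suc s) (highs (suc s))) (m≤n⇒m⊓n≡m s<len)
    , All.take⁺ (suc s) (highs-high (suc s))))
  ... | tri< len<s _ _ with lowThreshold (suc s) ≤? length (outside (highs (suc s)))
  ...   | yes long = inj₁ (lows⇒set (suc s) (outside (highs (suc s))) (outside-unique (highs (suc s)))
    (λ {x} {u} x∈ u∈x → ≤-trans (count-filter (inc? u) (λ e → ¬? (touch? (highs (suc s)) e)) edges)
                          (¬touch⇒low (suc s) {x} (outside-avoids x∈) u∈x))
    long)
  ...   | no short = inj₂ (inj₁ (≤-trans
    (numEdges≤ (highs-unique (suc s)) (<⇒≤ (≰⇒> short)))
    (touching-gap n-big len<s)))

  outside-choice : ∀ s {A x} → Unique A → length A ≡ s → x ∈ outside A →
                   All (λ T → threshold (jointBound 1) s ≤ count (x ~?_) T) (stars A) → CompatibleSet (suc s)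
  outside-choice s {A} {x} uA len x∈ rest = choice⇒set (cong suc (trans (length-stars A) len))
    (extend s (stars A) x∈ (trans (length-stars A) len) (stars-unique A) (stars-pairwise-few A) rest)

  high-stars-long : ∀ s {A} → Unique A → length A ≡ s → All (λ a → highDegree (suc s) ≤ deg a) A →
                    All (λ T → threshold (jointBound 1) s + (threshold (jointBound 1) s + jointBound 1) ≤ length T) (stars A)
  high-stars-long s {A} uA len high =
    All.map (≤-trans (m≤n+m _ (suc s))) (stars-long A uA (≤-trans (≤-reflexive len) (n≤1+n s)) high)

  numEdges≤-or-set : ∀ s → lowThreshold (suc s) + s ≤ n → CompatibleSet (suc s) ⊎ numEdges G ≤ touching n s + s
  numEdges≤-or-set s n-big with dichotomy s n-big
  ... | inj₁ set = inj₁ set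
  ... | inj₂ (inj₁ le) = inj₂ (≤-trans le (m≤m+n _ s))
  ... | inj₂ (inj₂ (A , uA , refl , high)) with length (outside A) ≤? length A
  ...   | yes le = inj₂ (numEdges≤ uA le)
  ...   | no gt =
    -- Each of the `s` stars disqualifies at most one of the more than `s` edges avoiding `A`.
    let x , x∈ , rest = pick (threshold (jointBound 1) s) (outside A) (stars A) (outside-unique A)
          (subst (_< length (outside A)) (≡.sym (length-stars A)) (≰⇒> gt))
          (stars-few (outside A) A outside-avoids)
          (high-stars-long s uA refl high)
    in inj₁ (outside-choice s uA refl x∈ rest)

  numEdges≤-or-set₀ : (∀ e → f e ≡ nothing) → ∀ s → lowThreshold (suc s) + s ≤ n →
                      CompatibleSet (suc s) ⊎ numEdges G ≤ touching n s
  numEdges≤-or-set₀ f≡nothing s n-big with dichotomy s n-big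
  ... | inj₁ set = inj₁ set
  ... | inj₂ (inj₁ le) = inj₂ le
  ... | inj₂ (inj₂ (A , uA , refl , high)) = go (outside A) refl
    where
    M = threshold (jointBound 1) s
    -- When `f` has no values, every edge incompatible with `x` is hit by `x`, so any one edge
    -- avoiding `A` leaves enough of each star. `B` runs through the tails of `A`.
    enough : ∀ {x} → x ∈ outside A → ∀ B → (∀ {b} → b ∈ B → b ∈ A) →
             All (λ T → M + (M + jointBound 1) ≤ length T) (stars B) → All (λ T → M ≤ count (x ~?_) T) (stars B)
    enough x∈ [] _ [] = []
    enough {x} x∈ (b ∷ B) ⊆ (long ∷ longs) =
      +-cancelʳ-≤ (hitBound 1) M _ (begin
        M + hitBound 1                                  ≤⟨ +-monoʳ-≤ M (m≤m+n (hitBound 1) (hitBound 1)) ⟩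
        M + jointBound 1                                ≤⟨ m≤n+m _ M ⟩
        M + (M + jointBound 1)                          ≤⟨ long ⟩
        length T                                        ≡⟨ ≡.sym (count-compl (x ~?_) T) ⟩
        count (x ~?_) T + count (λ y → ¬? (x ~? y)) T   ≤⟨ +-monoʳ-≤ _ fails ⟩
        count (x ~?_) T + hitBound 1                    ∎)
      ∷ enough x∈ B (⊆ ∘ there) longs
      where
      open ≤-Reasoning
      T = star b B
      isHit : ∀ {y} → y ∈ T → ¬ (x ~ y) → Hit x y
      isHit {y} _ ¬x~y with ≁⇒hit x y ¬x~y
      ... | inj₁ h = h
      ... | inj₂ eq = contradiction (trans (≡.sym eq) (f≡nothing y)) λ ()
      fails : count (λ y → ¬? (x ~? y)) T ≤ hitBound 1
      fails = ≤-trans (count-mono _ (hit? x) T isHit)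
        (count-hit 1 x T (star-unique b B)
          (count-inc-avoiding {x = x} (λ b∈x → outside-avoids x∈ (Any.map (λ { refl → b∈x }) (⊆ (here refl))))))
    go : ∀ O → outside A ≡ O → CompatibleSet (suc s) ⊎ numEdges G ≤ touching n s
    go [] eq = inj₂ (≤-trans (numEdges≤ uA (≤-reflexive (cong length eq))) (≤-reflexive (+-identityʳ _)))
    go (x ∷ _) eq = inj₁ (outside-choice s uA refl x∈ (enough x∈ A (λ b∈ → b∈) (high-stars-long s uA refl high)))
      where
      x∈ : x ∈ outside A
      x∈ = subst (x ∈_) (≡.sym eq) (here refl)

  set⇒matching : ∀ {t} → CompatibleSet t →
                 Σ (Matching G t) λ M → ∀ i j → i ≢ j → f (proj₁ M i) ≢ just (proj₁ M j)
  set⇒matching (L , refl , L~) = (lookup L , λ i j i≢j → proj₁ (compat i j i≢j)) , λ i j i≢j → proj₁ (proj₂ (compat i j i≢j))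
    where
    compat : ∀ i j → i ≢ j → lookup L i ~ lookup L j
    compat = allPairs-lookup (λ {e} {e'} → ~-sym {e} {e'}) L~

HGood⇒no-set : ∀ {n t} (G : Graph n) (good : HGood G t) →
               ¬ Compatible.CompatibleSet G (just ∘ proj₁ (proj₁ good)) t
HGood⇒no-set G ((f , f≢) , none) set = none (proj₁ found , free)
  where
  found = Compatible.set⇒matching G (just ∘ f) set
  free : FFree {G = G} f (proj₁ found)
  free i j same with i Fin.≟ j
  -- `FFree` includes the case `i = j`, which is excluded because `f` fixes no edge.
  ... | yes refl = f≢ _ same
  ... | no i≢j = proj₂ found i j i≢j (cong just (EdgeLists.edge-≡ G same))

HGood-upper : ∀ s {n} → lowThreshold (suc s) + s ≤ n →
              (G : Graph n) → HGood G (suc s) → numEdges G ≤ touching n s + s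
HGood-upper s n-big G good with Compatible.numEdges≤-or-set G (just ∘ proj₁ (proj₁ good)) s n-big
... | inj₂ le = le
... | inj₁ set = contradiction set (HGood⇒no-set G good)

TKFree-upper : ∀ s {n} → lowThreshold (suc s) + s ≤ n → (G : Graph n) → TKFree G (suc s) → numEdges G ≤ touching n s
TKFree-upper s n-big G none with Compatible.numEdges≤-or-set₀ G (λ _ → nothing) (λ _ → refl) s n-big
... | inj₂ le = le
... | inj₁ set = contradiction (proj₁ (Compatible.set⇒matching G (λ _ → nothing) set)) none

-- Upper bound for t = 2

count-exists : {A : Set} {P : A → Set} (P? : Decidable P) → ∀ xs → 1 ≤ count P? xs → ∃ λ x → x ∈ xs × P x
count-exists P? xs le with filter P? xs in eq
... | x ∷ _ = x , ∈-filter⁻ P? (subst (x ∈_) (≡.sym eq) (here refl))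

take-∈ : {A : Set} {x : A} → ∀ k xs → x ∈ take k xs → x ∈ xs
take-∈ (suc k) (y ∷ xs) (here p) = here p
take-∈ (suc k) (y ∷ xs) (there p) = there (take-∈ k xs p)

tight₃ : ∀ {a b c} → a ≤ 1 → b ≤ 1 → c ≤ 1 → 3 ≤ a + (b + c) → 1 ≤ a × 1 ≤ b × 1 ≤ c
tight₃ (s≤s z≤n) (s≤s z≤n) (s≤s z≤n) _ = s≤s z≤n , s≤s z≤n , s≤s z≤n
tight₃ z≤n       b≤1 c≤1 le = contradiction (≤-trans le (+-mono-≤ b≤1 c≤1)) λ { (s≤s (s≤s ())) }
tight₃ (s≤s z≤n) z≤n c≤1 le = contradiction (≤-trans le (s≤s c≤1)) λ { (s≤s (s≤s ())) }
tight₃ (s≤s z≤n) (s≤s z≤n) z≤n (s≤s (s≤s ()))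

enumerate : {A : Set} {k : ℕ} (xs : List A) → length xs ≡ k → Unique xs →
            Σ (Fin k → A) λ h → (∀ {i j} → h i ≡ h j → i ≡ j) × (∀ i → h i ∈ xs) × (∀ {x} → x ∈ xs → ∃ λ i → h i ≡ x)
enumerate xs refl u = lookup xs , unique-lookup-injective u , ∈-lookup , λ x∈ → Any.index x∈ , ≡.sym (lookup-index x∈)

-- For `i ≢ j` the remaining index: in K₄ the edge on `suc i` and `suc j` is disjoint from the one
-- joining `zero` to `suc (third i j)`.
third : Fin 3 → Fin 3 → Fin 3
third 0F 1F = 2F
third 1F 0F = 2F
third 0F 2F = 1F
third 2F 0F = 1F
third _  _  = 0F

-- The index of the perfect matching of K₄ that contains the edge ij.
parallelClass : Fin 4 → Fin 4 → Fin 3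
parallelClass zero    zero    = 0F
parallelClass zero    (suc j) = j
parallelClass (suc i) zero    = i
parallelClass (suc i) (suc j) = third i j

SamePair Apart : {A : Set} → A → A → A → A → Set
SamePair i j k l = (i ≡ k × j ≡ l) ⊎ (i ≡ l × j ≡ k)
Apart i j k l = i ≢ k × i ≢ l × j ≢ k × j ≢ l

abstract
  parallel : ∀ i j → i ≢ j → ∀ k l → k ≢ l → parallelClass i j ≡ parallelClass k l →
            SamePair i j k l ⊎ Apart i j k l
  parallel = toWitness {a? = Fin.all? λ i → Fin.all? λ j → ¬? (i Fin.≟ j) →-dec (Fin.all? λ k → Fin.all? λ l → ¬? (k Fin.≟ l) →-dec
   ((parallelClass i j Fin.≟ parallelClass k l) →-dec
     (((i Fin.≟ k ×-dec j Fin.≟ l) ⊎-dec (i Fin.≟ l ×-dec j Fin.≟ k))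
      ⊎-dec (¬? (i Fin.≟ k) ×-dec ¬? (i Fin.≟ l) ×-dec ¬? (j Fin.≟ k) ×-dec ¬? (j Fin.≟ l)))))} _

module NoFreePair {n : ℕ} (G : Graph n) (f : Edge G → Edge G)
                  (none : ∀ e e' → ¬ Compatible._~_ G (just ∘ f) e e') where
  open EdgeLists G
  open Compatible G (just ∘ f) hiding (star; star-inc; star-unique)

  covered : ∀ x y → Hit x y ⊎ f y ≡ x
  covered x y with ≁⇒hit x y (none x y)
  ... | inj₁ h = inj₁ h
  ... | inj₂ eq = inj₂ (just-injective eq)

  covered-⊥ : ∀ {x y} → x ⊥ y → f x ≡ y ⊎ f y ≡ x
  covered-⊥ {x} {y} x⊥y with covered x y
  ... | inj₁ (inj₁ eq) = inj₁ (just-injective eq)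
  ... | inj₁ (inj₂ (inj₁ p)) = contradiction p (⊥⇒¬inc {end₁ x} {x} {y} x⊥y (inj₁ refl))
  ... | inj₁ (inj₂ (inj₂ p)) = contradiction p (⊥⇒¬inc {end₂ x} {x} {y} x⊥y (inj₂ refl))
  ... | inj₂ eq = inj₂ eq

  covered₂ : ∀ {x x'} y → x ≢ x' → Hit x y ⊎ Hit x' y
  covered₂ {x} {x'} y x≢x' with covered x y | covered x' y
  ... | inj₁ h | _ = inj₁ h
  ... | inj₂ _ | inj₁ h = inj₂ h
  ... | inj₂ p | inj₂ q = contradiction (trans (≡.sym p) q) x≢x'

  -- Edges at a vertex against edges avoiding it

  module AtVertex (v : Fin n) where
    star rest : List (Edge G)
    star = filter (inc? v) edges
    rest = filter (λ e → ¬? (inc? v e)) edges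

    star-rest : deg v + length rest ≡ numEdges G
    star-rest = trans (count-compl (inc? v) edges) length-edges

    star-inc : ∀ {y} → y ∈ star → Inc v y
    star-inc y∈ = proj₂ (∈-filter⁻ (inc? v) {xs = edges} y∈)

    star-unique : Unique star
    star-unique = Unique.filter⁺ (inc? v) edges-unique

    rest-¬inc : ∀ {g} → g ∈ rest → ¬ Inc v g
    rest-¬inc g∈ = proj₂ (∈-filter⁻ (λ e → ¬? (inc? v e)) {xs = edges} g∈)

    rest-unique : Unique rest
    rest-unique = Unique.filter⁺ (λ e → ¬? (inc? v e)) edges-unique

    v≢end : ∀ {g u} → ¬ Inc v g → Inc u g → v ≢ u
    v≢end v∉g u∈g refl = v∉g u∈g

    Spoke : Fin n → Edge G → Set
    Spoke u y = Inc v y × Inc u y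

    spoke-one : ∀ {g u} → ¬ Inc v g → Inc u g → AtMostOne (Spoke u)
    spoke-one {g} v∉g u∈g (p , q) (p' , q') = edge-determined (v≢end {g} v∉g u∈g) p q p' q'

    Target : Edge G → Edge G → Set
    Target g y = f g ≡ y

    target-one : ∀ g → AtMostOne (Target g)
    target-one g p q = trans (≡.sym p) q

    -- Since f g = g' avoids v, the only spoke that can be hit without touching g or g' is f g'.
    star≤5-target : ∀ {g g'} → ¬ Inc v g → ¬ Inc v g' → g ≢ g' → f g ≡ g' → length star ≤ 5
    star≤5-target {g} {g'} v∉g v∉g' g≢g' fg = length≤cover
      (Target g' ∷ Spoke (end₁ g) ∷ Spoke (end₂ g) ∷ Spoke (end₁ g') ∷ Spoke (end₂ g') ∷ [])
      star-unique
      (target-one g' ∷ spoke-one {g} v∉g (inj₁ refl) ∷ spoke-one {g} v∉g (inj₂ refl)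
        ∷ spoke-one {g'} v∉g' (inj₁ refl) ∷ spoke-one {g'} v∉g' (inj₂ refl) ∷ [])
      cover
      where
      cover : ∀ {y} → y ∈ star → Any (λ Q → Q y) _
      cover {y} y∈ with covered₂ y g≢g'
      ... | inj₁ (inj₁ refl) = contradiction (subst (Inc v) fg (star-inc y∈)) v∉g'
      ... | inj₁ (inj₂ (inj₁ p)) = there (here (star-inc y∈ , p))
      ... | inj₁ (inj₂ (inj₂ p)) = there (there (here (star-inc y∈ , p)))
      ... | inj₂ (inj₁ eq) = here (just-injective eq)
      ... | inj₂ (inj₂ (inj₁ p)) = there (there (there (here (star-inc y∈ , p))))
      ... | inj₂ (inj₂ (inj₂ p)) = there (there (there (there (here (star-inc y∈ , p)))))

    -- Two meeting edges have at most three ends between them: those of `g`, and `z`. This saves one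
    -- spoke in `star≤5-meeting`.
    free-end : ∀ g g' → ¬ (g ⊥ g') → ∃ λ z → Inc z g' × (∀ {u} → Inc u g' → Inc u g ⊎ u ≡ z)
    free-end g g' meet with meets-at-end g g' meet
    ... | inj₁ (inj₁ eq) = end₂ g' , inj₂ refl , λ { (inj₁ refl) → inj₁ (inj₁ (≡.sym eq)) ; (inj₂ refl) → inj₂ refl }
    ... | inj₁ (inj₂ eq) = end₁ g' , inj₁ refl , λ { (inj₁ refl) → inj₂ refl ; (inj₂ refl) → inj₁ (inj₁ (≡.sym eq)) }
    ... | inj₂ (inj₁ eq) = end₂ g' , inj₂ refl , λ { (inj₁ refl) → inj₁ (inj₂ (≡.sym eq)) ; (inj₂ refl) → inj₂ refl }
    ... | inj₂ (inj₂ eq) = end₁ g' , inj₁ refl , λ { (inj₁ refl) → inj₂ refl ; (inj₂ refl) → inj₁ (inj₂ (≡.sym eq)) }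

    -- Every spoke is hit by `g` or `g'`, hence is `f g`, `f g'` or one of the three spokes at their
    -- ends.
    star≤5-meeting : ∀ {g g'} → ¬ Inc v g → ¬ Inc v g' → g ≢ g' → ¬ (g ⊥ g') → length star ≤ 5
    star≤5-meeting {g} {g'} v∉g v∉g' g≢g' meet = length≤cover
      (Target g ∷ Target g' ∷ Spoke (end₁ g) ∷ Spoke (end₂ g) ∷ Spoke z ∷ [])
      star-unique
      (target-one g ∷ target-one g' ∷ spoke-one {g} v∉g (inj₁ refl) ∷ spoke-one {g} v∉g (inj₂ refl)
        ∷ spoke-one {g'} v∉g' (proj₁ (proj₂ (free-end g g' meet))) ∷ [])
      cover
      where
      z = proj₁ (free-end g g' meet)
      Cover : Edge G → Set₁
      Cover y = Any (λ Q → Q y) (Target g ∷ Target g' ∷ Spoke (end₁ g) ∷ Spoke (end₂ g) ∷ Spoke z ∷ [])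
      at-end : ∀ {u y} → y ∈ star → Inc u g' → Inc u y → Cover y
      at-end y∈ u∈g' u∈y with proj₂ (proj₂ (free-end g g' meet)) u∈g'
      ... | inj₁ (inj₁ refl) = there (there (here (star-inc y∈ , u∈y)))
      ... | inj₁ (inj₂ refl) = there (there (there (here (star-inc y∈ , u∈y))))
      ... | inj₂ refl = there (there (there (there (here (star-inc y∈ , u∈y)))))
      cover : ∀ {y} → y ∈ star → Cover y
      cover {y} y∈ with covered₂ y g≢g'
      ... | inj₁ (inj₁ eq) = here (just-injective eq)
      ... | inj₁ (inj₂ (inj₁ p)) = there (there (here (star-inc y∈ , p)))
      ... | inj₁ (inj₂ (inj₂ p)) = there (there (there (here (star-inc y∈ , p))))
      ... | inj₂ (inj₁ eq) = there (here (just-injective eq))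
      ... | inj₂ (inj₂ (inj₁ p)) = at-end {end₁ g'} y∈ (inj₁ refl) p
      ... | inj₂ (inj₂ (inj₂ p)) = at-end {end₂ g'} y∈ (inj₂ refl) p

    star≤5 : ∀ {g g'} → ¬ Inc v g → ¬ Inc v g' → g ≢ g' → length star ≤ 5
    star≤5 {g} {g'} v∉g v∉g' g≢g' with g ⊥? g'
    ... | no meet = star≤5-meeting v∉g v∉g' g≢g' meet
    -- Disjoint edges are never compatible here, so one is the image of the other.
    ... | yes disj with covered-⊥ {g} {g'} disj
    ...   | inj₁ fg = star≤5-target v∉g v∉g' g≢g' fg
    ...   | inj₂ fg' = star≤5-target v∉g' v∉g (g≢g' ∘ ≡.sym) fg'

    count-hit-star : ∀ {g} → ¬ Inc v g → count (hit? g) star ≤ 3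
    count-hit-star {g} v∉g = count-hit 1 g star star-unique
      λ u∈g → count-inc-star star-unique star-inc (v≢end {g} v∉g u∈g)

    -- A spoke `y` is hit by every edge of `gs` except possibly `f y`, that is, by at least `k` of
    -- the `suc k`.
    star-double-count : ∀ {k} gs → Unique gs → length gs ≡ suc k →
                        length star * k ≤ sum (map (λ g → count (hit? g) star) gs)
    star-double-count {k} gs ugs len = ≤-trans
      (sum-map-≥ (λ y → count (λ g → hit? g y) gs) k star (λ {y} _ → many y))
      (≤-reflexive (≡.sym (double-count hit? gs star)))
      where
      many : ∀ y → k ≤ count (λ g → hit? g y) gs
      many y = ≤-pred (begin
        suc k                                                             ≡⟨ ≡.sym len ⟩
        length gs                                                         ≡⟨ ≡.sym (count-compl (λ g → hit? g y) gs) ⟩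
        count (λ g → hit? g y) gs + count (λ g → ¬? (hit? g y)) gs        ≤⟨ +-monoʳ-≤ _ (count≤1 _ ugs λ _ _ p q → trans (≡.sym (aim p)) (aim q)) ⟩
        count (λ g → hit? g y) gs + 1                                     ≡⟨ +-comm _ 1 ⟩
        suc (count (λ g → hit? g y) gs)                                   ∎)
        where
        open ≤-Reasoning
        aim : ∀ {g} → ¬ Hit g y → f y ≡ g
        aim {g} ¬h = [ (λ h → contradiction h ¬h) , (λ eq → eq) ]′ (covered g y)

    module _ {k : ℕ} (long : k ≤ length rest) where
      firsts : List (Edge G)
      firsts = take k rest

      firsts-length : length firsts ≡ k
      firsts-length = trans (length-take k rest) (m≤n⇒m⊓n≡m long)

      firsts-unique : Unique firsts
      firsts-unique = Unique.take⁺ k rest-unique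

      firsts-¬inc : ∀ {g} → g ∈ firsts → ¬ Inc v g
      firsts-¬inc g∈ = rest-¬inc (take-∈ k rest g∈)

    deg<5 : 3 ≤ length rest → deg v < 5
    -- Five spokes are hit at least twice each, while three edges hit at most three spokes each: 10
    -- against 9.
    deg<5 long = ≰⇒> λ 5≤deg → <⇒≱ (≤-refl {10}) (begin
      5 * 2                                                    ≤⟨ *-monoˡ-≤ 2 5≤deg ⟩
      deg v * 2                                                ≤⟨ star-double-count gs (firsts-unique long) (firsts-length long) ⟩
      sum (map (λ g → count (hit? g) star) gs)                 ≤⟨ sum-map-≤ _ 3 gs (λ g∈ → count-hit-star (firsts-¬inc long g∈)) ⟩
      length gs * 3                                            ≡⟨ cong (_* 3) (firsts-length long) ⟩
      9                                                        ∎)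
      where
      open ≤-Reasoning
      gs = firsts long

    -- Three of the spokes are hit only if f g is a spoke and both ends of g are neighbours of v.
    Surrounded : Edge G → Set
    Surrounded g = f g ∈ star × (∃ λ y → y ∈ star × Inc (end₁ g) y) × (∃ λ y → y ∈ star × Inc (end₂ g) y)

    hit3⇒surrounded : ∀ {g} → ¬ Inc v g → 3 ≤ count (hit? g) star → Surrounded g
    hit3⇒surrounded {g} v∉g le =
      let a , b , c = tight₃ (count≤1 target? star-unique (λ _ _ → target-one g))
                        (end≤1 (inj₁ refl)) (end≤1 (inj₂ refl)) total
          y , y∈ , fg≡y = count-exists target? star a
      in subst (_∈ star) (≡.sym fg≡y) y∈ , count-exists (inc? (end₁ g)) star b , count-exists (inc? (end₂ g)) star c
      where
      target? : ∀ y → Dec (f g ≡ y)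
      target? y = f g ≟ᴱ y
      meets? : ∀ y → Dec (Inc (end₁ g) y ⊎ Inc (end₂ g) y)
      meets? y = inc? (end₁ g) y ⊎-dec inc? (end₂ g) y
      end≤1 : ∀ {u} → Inc u g → count (inc? u) star ≤ 1
      end≤1 u∈g = count-inc-star star-unique star-inc (v≢end {g} v∉g u∈g)
      total : 3 ≤ count target? star + (count (inc? (end₁ g)) star + count (inc? (end₂ g)) star)
      total = ≤-trans le (≤-trans
        (count-⊎ (hit? g) target? meets? star (λ _ → [ inj₁ ∘ just-injective , inj₂ ]′))
        (+-monoʳ-≤ (count target? star) (count-⊎ meets? (inc? (end₁ g)) (inc? (end₂ g)) star (λ _ p → p))))

    opposite : ∀ {p q y} → v ≢ p → v ≢ q → Inc v y → Inc p y → Inc q y → p ≡ q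
    opposite v≢p v≢q (inj₁ refl) (inj₁ p) _ = contradiction (≡.sym p) v≢p
    opposite v≢p v≢q (inj₁ refl) _ (inj₁ q) = contradiction (≡.sym q) v≢q
    opposite v≢p v≢q (inj₁ refl) (inj₂ p) (inj₂ q) = trans p (≡.sym q)
    opposite v≢p v≢q (inj₂ refl) (inj₂ p) _ = contradiction (≡.sym p) v≢p
    opposite v≢p v≢q (inj₂ refl) _ (inj₂ q) = contradiction (≡.sym q) v≢q
    opposite v≢p v≢q (inj₂ refl) (inj₁ p) (inj₁ q) = trans p (≡.sym q)

    module _ (spoke : Fin 4 → Edge G) (spoke-injective : ∀ {i j} → spoke i ≡ spoke j → i ≡ j)
             (v∈spoke : ∀ i → Inc v (spoke i))
             (g : Fin 4 → Edge G) (g-injective : ∀ {a b} → g a ≡ g b → a ≡ b) (v∉g : ∀ a → ¬ Inc v (g a))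
             (i j : Fin 4 → Fin 4)
             (end₁∈ : ∀ a → Inc (end₁ (g a)) (spoke (i a))) (end₂∈ : ∀ a → Inc (end₂ (g a)) (spoke (j a))) where
      private
        v≢₁ : ∀ a → v ≢ end₁ (g a)
        v≢₁ a = v≢end {g a} (v∉g a) (inj₁ refl)

        v≢₂ : ∀ a → v ≢ end₂ (g a)
        v≢₂ a = v≢end {g a} (v∉g a) (inj₂ refl)

        same-end : ∀ {p q k l} → v ≢ p → v ≢ q → Inc p (spoke k) → Inc q (spoke l) → k ≡ l → p ≡ q
        same-end {k = k} v≢p v≢q p∈ q∈ refl = opposite {y = spoke k} v≢p v≢q (v∈spoke k) p∈ q∈

        same-spoke : ∀ {p q k l} → v ≢ p → Inc p (spoke k) → Inc q (spoke l) → p ≡ q → k ≡ l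
        same-spoke {k = k} {l} v≢p p∈ q∈ refl =
          spoke-injective (edge-determined v≢p (v∈spoke k) p∈ (v∈spoke l) q∈)

        i≢j : ∀ a → i a ≢ j a
        i≢j a eq = <⇒≢ (ends< (g a)) (cong Fin.toℕ (same-end {k = i a} (v≢₁ a) (v≢₂ a) (end₁∈ a) (end₂∈ a) eq))

        not-same : ∀ a b → a ≢ b → ¬ SamePair (i a) (j a) (i b) (j b)
        not-same a b a≢b (inj₁ (p , q)) = a≢b (g-injective (edge-≡ (cong₂ _,_
          (same-end (v≢₁ a) (v≢₁ b) (end₁∈ a) (end₁∈ b) p)
          (same-end (v≢₂ a) (v≢₂ b) (end₂∈ a) (end₂∈ b) q))))
        not-same a b a≢b (inj₂ (p , q)) = a≢b (g-injective (edge-determined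
          (λ eq → <⇒≢ (ends< (g a)) (cong Fin.toℕ eq)) (inj₁ refl) (inj₂ refl)
          (inj₂ (same-end (v≢₁ a) (v≢₂ b) (end₁∈ a) (end₂∈ b) p))
          (inj₁ (same-end (v≢₂ a) (v≢₁ b) (end₂∈ a) (end₁∈ b) q))))

        apart : ∀ a b → Apart (i a) (j a) (i b) (j b) → g a ⊥ g b
        apart a b (p , q , r , s) =
            p ∘ same-spoke (v≢₁ a) (end₁∈ a) (end₁∈ b)
          , q ∘ same-spoke (v≢₁ a) (end₁∈ a) (end₂∈ b)
          , r ∘ same-spoke (v≢₂ a) (end₂∈ a) (end₁∈ b)
          , s ∘ same-spoke (v≢₂ a) (end₂∈ a) (end₂∈ b)

      -- The spokes number the four neighbours of `v`, so the `g a` are four different edges of a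
      -- K₄. Two of them lie in the same one of its three perfect matchings.
      disjoint-pair : ∃ λ a → ∃ λ b → g a ⊥ g b
      disjoint-pair with Fin.pigeonhole ≤-refl (λ a → parallelClass (i a) (j a))
      ... | a , b , a<b , same with parallel (i a) (j a) (i≢j a) (i b) (j b) (i≢j b) same
      ...   | inj₁ eq = contradiction eq (not-same a b (<⇒≢ a<b ∘ cong Fin.toℕ))
      ...   | inj₂ ap = a , b , apart a b ap

    deg≢4 : 4 ≤ length rest → deg v ≢ 4
    deg≢4 long deg≡4
      with enumerate star deg≡4 star-unique
         | enumerate (firsts long) (firsts-length long) (firsts-unique long)
    ... | spoke , spoke-inj , spoke∈ , spoke-onto | g , g-inj , g∈ , _ =
      let a , b , disj = disjoint-pair spoke spoke-inj (λ i → star-inc (spoke∈ i)) g g-inj v∉g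
            (λ a → proj₁ (at₁ a)) (λ a → proj₁ (at₂ a)) (λ a → proj₂ (at₁ a)) (λ a → proj₂ (at₂ a))
      -- The images of `g a` and `g b` are spokes, whereas both edges avoid `v`; neither can be the
      -- image of the other.
      in [ (λ eq → v∉g b (subst (Inc v) eq (star-inc (proj₁ (surrounded a)))))
         , (λ eq → v∉g a (subst (Inc v) eq (star-inc (proj₁ (surrounded b))))) ]′ (covered-⊥ {g a} {g b} disj)
      where
      v∉g : ∀ a → ¬ Inc v (g a)
      v∉g a = firsts-¬inc long (g∈ a)
      -- Four spokes hit at least three times each, by four edges hitting at most three spokes each:
      -- 12 on both sides, so every edge attains its maximum.
      tight : length (firsts long) * 3 ≤ sum (map (λ g → count (hit? g) star) (firsts long))
      tight = ≤-trans (≤-reflexive (cong (_* 3) (trans (firsts-length long) (≡.sym deg≡4))))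
        (star-double-count (firsts long) (firsts-unique long) (firsts-length long))
      surrounded : ∀ a → Surrounded (g a)
      surrounded a = hit3⇒surrounded (v∉g a)
        (sum-map-tight (λ g → count (hit? g) star) 3 (firsts long) (λ g∈ → count-hit-star (firsts-¬inc long g∈))
          tight (g∈ a))
      locate : ∀ {u} → (∃ λ y → y ∈ star × Inc u y) → ∃ λ i → Inc u (spoke i)
      locate {u} (y , y∈ , u∈y) = let i , eq = spoke-onto y∈ in i , subst (Inc u) (≡.sym eq) u∈y
      at₁ : ∀ a → ∃ λ i → Inc (end₁ (g a)) (spoke i)
      at₁ a = locate (proj₁ (proj₂ (surrounded a)))
      at₂ : ∀ a → ∃ λ i → Inc (end₂ (g a)) (spoke i)
      at₂ a = locate (proj₂ (proj₂ (surrounded a)))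

    -- More than `n` edges leave two that avoid `v`, so the degree is at most 5; eight edges then
    -- leave three, so it is at most 4; degree 4 would leave four, which `deg≢4` excludes.
    deg<4 : 8 ≤ numEdges G → n < numEdges G → deg v < 4
    deg<4 m≥8 m>n with <-cmp (deg v) 4
    ... | tri< lt _ _ = lt
    ... | tri≈ _ eq _ = contradiction eq (deg≢4 (+-cancelˡ-≤ 4 4 (length rest)
      (≤-trans m≥8 (≤-reflexive (trans (≡.sym star-rest) (cong (_+ length rest) eq))))))
    ... | tri> _ _ gt = contradiction gt (<⇒≱ (deg<5 rest≥3))
      where
      rest≥2 : 2 ≤ length rest
      rest≥2 = +-cancelˡ-≤ (deg v) 2 (length rest) (begin
        deg v + 2            ≡⟨ +-comm (deg v) 2 ⟩
        suc (suc (deg v))    ≤⟨ s≤s (deg<n v) ⟩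
        suc n                ≤⟨ m>n ⟩
        numEdges G           ≡⟨ ≡.sym star-rest ⟩
        deg v + length rest  ∎)
        where open ≤-Reasoning
      two : ∀ gs → Unique gs → 2 ≤ length gs → (∀ {g} → g ∈ gs → ¬ Inc v g) → length star ≤ 5
      two (g ∷ g' ∷ _) ((g≢g' ∷ _) ∷ _) _ v∉ = star≤5 (v∉ (here refl)) (v∉ (there (here refl))) g≢g'
      two (_ ∷ []) _ (s≤s ()) _
      rest≥3 : 3 ≤ length rest
      rest≥3 = +-cancelˡ-≤ 5 3 (length rest) (≤-trans m≥8 (≤-trans (≤-reflexive (≡.sym star-rest))
        (+-monoˡ-≤ (length rest) (two rest rest-unique rest≥2 rest-¬inc))))

  -- With all degrees at most 3 an edge meets at most 4 others, so f must map at least two edges to it.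
  indegree≥2 : 8 ≤ numEdges G → (∀ v → deg v ≤ 3) → ∀ {e} → e ∈ edges → 2 ≤ count (λ y → f y ≟ᴱ e) edges
  indegree≥2 m≥8 low {e} e∈ = +-cancelˡ-≤ 6 2 _ (begin
    8                                                        ≤⟨ m≥8 ⟩
    numEdges G                                               ≡⟨ ≡.sym length-edges ⟩
    length edges                                             ≡⟨ ≡.sym (count-compl at₁? edges) ⟩
    deg (end₁ e) + count (λ y → ¬? (at₁? y)) edges           ≤⟨ +-mono-≤ (low (end₁ e)) (count-⊎ _ only₂? other? edges split) ⟩
    3 + (count only₂? edges + count other? edges)            ≤⟨ +-monoʳ-≤ 3 (+-mono-≤ only₂≤2 (count-⊎ other? out? in? edges (λ _ p → p))) ⟩
    3 + (2 + (count out? edges + count in? edges))           ≤⟨ +-monoʳ-≤ 5 (+-monoˡ-≤ _ (count≤1 out? edges-unique (λ _ _ p q → trans (≡.sym p) q))) ⟩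
    6 + count in? edges                                      ∎)
    where
    open ≤-Reasoning
    at₁? : ∀ y → Dec (Inc (end₁ e) y)
    at₁? = inc? (end₁ e)
    only₂? : ∀ y → Dec (Inc (end₂ e) y × ¬ Inc (end₁ e) y)
    only₂? y = inc? (end₂ e) y ×-dec ¬? (at₁? y)
    out? : ∀ y → Dec (f e ≡ y)
    out? y = f e ≟ᴱ y
    in? : ∀ y → Dec (f y ≡ e)
    in? y = f y ≟ᴱ e
    other? : ∀ y → Dec (f e ≡ y ⊎ f y ≡ e)
    other? y = out? y ⊎-dec in? y
    split : ∀ {y} → y ∈ edges → ¬ Inc (end₁ e) y → (Inc (end₂ e) y × ¬ Inc (end₁ e) y) ⊎ (f e ≡ y ⊎ f y ≡ e)
    split {y} _ ¬₁ with covered e y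
    ... | inj₁ (inj₁ eq) = inj₂ (inj₁ (just-injective eq))
    ... | inj₁ (inj₂ (inj₁ p)) = contradiction p ¬₁
    ... | inj₁ (inj₂ (inj₂ p)) = inj₁ (p , ¬₁)
    ... | inj₂ eq = inj₂ (inj₂ eq)
    -- One of the at most three edges at `end₂ e` is `e` itself, which also meets `end₁ e`.
    only₂≤2 : count only₂? edges ≤ 2
    only₂≤2 = ≤-pred (≤-trans
      (s≤s (count≤count-filter only₂? (inc? (end₂ e)) edges (λ _ → proj₁)))
      (≤-trans (filter-notAll only₂? _ (lose (∈-filter⁺ (inc? (end₂ e)) e∈ (inj₂ refl)) (λ p → proj₂ p (inj₁ refl))))
        (low (end₂ e))))

  -- Counting the pairs of an edge and its image: one for each edge as argument, but at least two
  -- for each edge as image.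
  too-many-edges : 8 ≤ numEdges G → ¬ (n < numEdges G)
  too-many-edges m≥8 m>n = <⇒≱ (m<m*n (length edges) 2 {{ℕ.>-nonZero m>0}} ≤-refl) (begin
    length edges * 2                                          ≤⟨ sum-map-≥ _ 2 edges (indegree≥2 m≥8 (λ v → ≤-pred (AtVertex.deg<4 v m≥8 m>n))) ⟩
    sum (map (λ e → count (λ y → f y ≟ᴱ e) edges) edges)      ≡⟨ ≡.sym (double-count (λ y e → f y ≟ᴱ e) edges edges) ⟩
    sum (map (λ y → count (λ e → f y ≟ᴱ e) edges) edges)      ≤⟨ sum-map-≤ _ 1 edges (λ {y} _ →
                                                                    count≤1 (f y ≟ᴱ_) edges-unique (λ _ _ p q → trans (≡.sym p) q)) ⟩
    length edges * 1                                          ≡⟨ *-identityʳ _ ⟩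
    length edges                                              ∎)
    where
    open ≤-Reasoning
    m>0 : 0 < length edges
    m>0 = ≤-trans (s≤s z≤n) (≤-trans m≥8 (≤-reflexive (≡.sym length-edges)))

HGood₂-upper : ∀ {n} (G : Graph n) → HGood G 2 → 8 ≤ numEdges G → numEdges G ≤ n
HGood₂-upper G good m≥8 = ≮⇒≥ (NoFreePair.too-many-edges G (proj₁ (proj₁ good))
  (λ e e' e~e' → HGood⇒no-set G good (e ∷ e' ∷ [] , refl , (e~e' ∷ []) ∷ [] ∷ [])) m≥8)

-- Extremal graphs

ind≡numBool : {X : Set} (d : Dec X) (b : Bool) → (b ≡ true → X) → (X → b ≡ true) → ind d ≡ numBool b
ind≡numBool d true  to _ = cong numBool (dec-true d (to refl))
ind≡numBool d false _ from = cong numBool (dec-false d λ x → contradiction (from x) λ ())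

count-map : {A B : Set} {P : B → Set} (P? : Decidable P) (g : A → B) → ∀ xs → count P? (map g xs) ≡ count (P? ∘ g) xs
count-map P? g [] = refl
count-map P? g (x ∷ xs) = trans (count-∷ P? (g x) (map g xs))
  (trans (cong (ind (P? (g x)) +_) (count-map P? g xs)) (≡.sym (count-∷ (P? ∘ g) x xs)))

count-++ : {A : Set} {P : A → Set} (P? : Decidable P) → ∀ xs ys → count P? (xs ++ ys) ≡ count P? xs + count P? ys
count-++ P? xs ys = trans (cong length (filter-++ P? xs ys)) (length-++ (filter P? xs))

count-cartesianProduct : {A B : Set} {P : A × B → Set} (P? : Decidable P) → ∀ xs ys →
  count P? (cartesianProduct xs ys) ≡ sum (map (λ x → count (λ y → P? (x , y)) ys) xs)
count-cartesianProduct P? [] ys = refl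
count-cartesianProduct P? (x ∷ xs) ys = trans (count-++ P? (map (x ,_) ys) (cartesianProduct xs ys))
  (cong₂ _+_ (count-map P? (x ,_) ys) (count-cartesianProduct P? xs ys))

sum-tabulate-cong : ∀ {n} {g h : Fin n → ℕ} → (∀ i → g i ≡ h i) → sum (tabulate g) ≡ sum (tabulate h)
sum-tabulate-cong {zero} eq = refl
sum-tabulate-cong {suc n} eq = cong₂ _+_ (eq zero) (sum-tabulate-cong (eq ∘ suc))

sum-tabulate-const : ∀ n c → sum (tabulate {n = n} (λ _ → c)) ≡ n * c
sum-tabulate-const zero c = refl
sum-tabulate-const (suc n) c = cong (c +_) (sum-tabulate-const n c)

pairSum : (ℕ → ℕ → Bool) → ℕ → ℕ
pairSum q n = sum (tabulate {n = n} λ i → sum (tabulate {n = n} λ j → numBool (q (toℕ i) (toℕ j))))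

-- A relation on ℕ above the diagonal describes graphs of all orders at once and lists each edge
-- exactly once.
module Upward (q : ℕ → ℕ → Bool) (q⇒< : ∀ i j → q i j ≡ true → i < j) where

  q-irrefl : ∀ i → q i i ≡ false
  q-irrefl i = Bool.¬-not (λ eq → <-irrefl refl (q⇒< i i eq))

  graph : ∀ n → Graph n
  adj (graph n) i j = q (toℕ i) (toℕ j) ∨ q (toℕ j) (toℕ i)
  sym (graph n) i j = Bool.∨-comm (q (toℕ i) (toℕ j)) (q (toℕ j) (toℕ i))
  irrefl (graph n) i rewrite q-irrefl (toℕ i) = refl

  adj≡q : ∀ {n} {i j : Fin n} → i Fin.< j → adj (graph n) i j ≡ q (toℕ i) (toℕ j)
  adj≡q {i = i} {j} i<j rewrite Bool.¬-not {q (toℕ j) (toℕ i)} (λ eq → <-asym i<j (q⇒< _ _ eq)) =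
    Bool.∨-identityʳ (q (toℕ i) (toℕ j))

  edge-q : ∀ {n} (e : Edge (graph n)) → q (toℕ (proj₁ (proj₁ e))) (toℕ (proj₂ (proj₁ e))) ≡ true
  edge-q (_ , i<j , a) = trans (≡.sym (adj≡q i<j)) a

  mkEdge : ∀ {n i j} → (i<n : i < n) (j<n : j < n) → q i j ≡ true → Edge (graph n)
  mkEdge {n} {i} {j} i<n j<n qij = (fromℕ< i<n , fromℕ< j<n) , lt , trans (adj≡q lt) q′
    where
    q′ : q (toℕ (fromℕ< i<n)) (toℕ (fromℕ< j<n)) ≡ true
    q′ = trans (cong₂ q (Fin.toℕ-fromℕ< i<n) (Fin.toℕ-fromℕ< j<n)) qij
    lt : fromℕ< i<n Fin.< fromℕ< j<n
    lt = q⇒< _ _ q′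

  numEdges-graph : ∀ n → numEdges (graph n) ≡ pairSum q n
  numEdges-graph n = begin
    numEdges (graph n)
      ≡⟨ count-cartesianProduct edge? (allFin n) (allFin n) ⟩
    sum (map (λ i → count (λ j → edge? (i , j)) (allFin n)) (allFin n))
      ≡⟨ cong sum (map-tabulate id (λ i → count (λ j → edge? (i , j)) (allFin n))) ⟩
    sum (tabulate λ i → count (λ j → edge? (i , j)) (allFin n))
      ≡⟨ sum-tabulate-cong (λ i → trans (count≡sum (λ j → edge? (i , j)) (allFin n))
           (trans (cong sum (map-tabulate id (λ j → ind (edge? (i , j))))) (sum-tabulate-cong (entry i)))) ⟩
    pairSum q n ∎
    where
    open ≡-Reasoning
    edge? : ∀ p → Dec (IsEdge (graph n) p)
    edge? = isEdge? (graph n)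
    entry : ∀ i j → ind (edge? (i , j)) ≡ numBool (q (toℕ i) (toℕ j))
    entry i j = ind≡numBool (edge? (i , j)) (q (toℕ i) (toℕ j))
      (λ eq → q⇒< _ _ eq , trans (adj≡q {i = i} {j} (q⇒< _ _ eq)) eq)
      (λ { (lt , a) → trans (≡.sym (adj≡q lt)) a })

-- i j is an edge iff i < j and either i < s, or i = s and j ≤ s + k:
-- s dominating vertices, and a star with k edges on the remaining vertices.
dominated : ℕ → ℕ → ℕ → ℕ → Bool
dominated s       k i       zero    = false
dominated (suc s) k zero    (suc j) = true
dominated zero    k zero    (suc j) = j <ᵇ k
dominated zero    k (suc i) (suc j) = false
dominated (suc s) k (suc i) (suc j) = dominated s k i j

dominated⇒< : ∀ s k i j → dominated s k i j ≡ true → i < j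
dominated⇒< (suc s) k zero    (suc j) _ = s≤s z≤n
dominated⇒< zero    k zero    (suc j) _ = s≤s z≤n
dominated⇒< (suc s) k (suc i) (suc j) eq = s≤s (dominated⇒< s k i j eq)

dominated-cases : ∀ s k i j → dominated s k i j ≡ true → i < s ⊎ (i ≡ s × ∃ λ l → l < k × j ≡ suc (s + l))
dominated-cases (suc s) k zero    (suc j) _ = inj₁ (s≤s z≤n)
dominated-cases zero    k zero    (suc j) eq = inj₂ (refl , j , <ᵇ⇒< j k (subst IsTrue (≡.sym eq) _) , refl)
dominated-cases (suc s) k (suc i) (suc j) eq with dominated-cases s k i j eq
... | inj₁ lt = inj₁ (s≤s lt)
... | inj₂ (eq₁ , l , lt , eq₂) = inj₂ (cong suc eq₁ , l , lt , cong suc eq₂)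

<⇒<ᵇ≡true : ∀ {m n} → m < n → (m <ᵇ n) ≡ true
<⇒<ᵇ≡true {m} {n} m<n with m <ᵇ n | <⇒<ᵇ m<n
... | true | _ = refl

dominated-star : ∀ s k {l} → l < k → dominated s k s (suc (s + l)) ≡ true
dominated-star zero    k l<k = <⇒<ᵇ≡true l<k
dominated-star (suc s) k l<k = dominated-star s k l<k

sum-initial : ∀ m k → k ≤ m → sum (tabulate {n = m} λ j → numBool (toℕ j <ᵇ k)) ≡ k
sum-initial m zero _ = trans (sum-tabulate-const m 0) (*-zeroʳ m)
sum-initial (suc m) (suc k) (s≤s k≤m) = cong suc (sum-initial m k k≤m)

-- The first dominating vertex has `s + m` neighbours, and deleting it leaves the same pattern with
-- one dominating vertex fewer. In the base case `k < m` makes room for the star.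
dominated-sum : ∀ s k m → k < m → pairSum (dominated s k) (s + m) ≡ s * m + s C 2 + k
dominated-sum zero k (suc m) (s≤s k≤m) = trans
  (cong₂ _+_ (sum-initial m k k≤m)
    (trans (sum-tabulate-cong {m} (λ i → trans (sum-tabulate-const m 0) (*-zeroʳ m)))
      (trans (sum-tabulate-const m 0) (*-zeroʳ m))))
  (+-identityʳ k)
dominated-sum (suc s) k m k<m = begin
  sum (tabulate {n = s + m} (λ _ → 1)) + _  ≡⟨ cong₂ _+_ (trans (sum-tabulate-const (s + m) 1) (*-identityʳ (s + m))) (dominated-sum s k m k<m) ⟩
  s + m + (s * m + s C 2 + k)
    ≡⟨ solve 5 (λ s m x c k → s :+ m :+ (x :+ c :+ k) := m :+ x :+ (s :+ c) :+ k) refl s m (s * m) (s C 2) k ⟩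
  m + s * m + (s + s C 2) + k               ≡⟨ cong (λ z → m + s * m + z + k) (≡.sym (C2-suc s)) ⟩
  suc s * m + suc s C 2 + k                 ∎
  where
  open ≡-Reasoning
  open Data.Nat.Solver.+-*-Solver

module Dominated (s k n : ℕ) where
  open Upward (dominated s k) (dominated⇒< s k) public
  open EdgeLists (graph n) using (end₁; end₂) public

  numEdges-dominated : s + k < n → numEdges (graph n) ≡ s * (n ∸ s) + s C 2 + k
  numEdges-dominated lt = begin
    numEdges (graph n)                  ≡⟨ cong (λ n → numEdges (graph n)) (≡.sym (m+[n∸m]≡n s≤n)) ⟩
    numEdges (graph (s + (n ∸ s)))      ≡⟨ numEdges-graph (s + (n ∸ s)) ⟩
    _                                   ≡⟨ dominated-sum s k (n ∸ s) k<n∸s ⟩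
    s * (n ∸ s) + s C 2 + k             ∎
    where
    open ≡-Reasoning
    s≤n : s ≤ n
    s≤n = ≤-trans (m≤m+n s k) (<⇒≤ lt)
    k<n∸s : k < n ∸ s
    k<n∸s = m+n≤o⇒m≤o∸n (suc k) (≤-trans (≤-reflexive (cong suc (+-comm k s))) lt)

  Dominating Extra : Edge (graph n) → Set
  Dominating e = ∃ λ (a : Fin s) → toℕ (end₁ e) ≡ toℕ a
  Extra e = ∃ λ (b : Fin k) → toℕ (end₁ e) ≡ s × toℕ (end₂ e) ≡ suc (s + toℕ b)

  kind : ∀ e → Dominating e ⊎ Extra e
  kind e with dominated-cases s k (toℕ (end₁ e)) (toℕ (end₂ e)) (edge-q e)
  ... | inj₁ lt = inj₁ (fromℕ< lt , ≡.sym (Fin.toℕ-fromℕ< lt))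
  ... | inj₂ (eq₁ , l , lt , eq₂) = inj₂ (fromℕ< lt , eq₁ , trans eq₂ (cong (λ l → suc (s + l)) (≡.sym (Fin.toℕ-fromℕ< lt))))

-- For `k = 0` the smaller end of every edge is one of the `s` dominating vertices, and two of
-- `suc s` edges share it.
TKFree-dominated : ∀ s n → TKFree (Dominated.graph s 0 n n) (suc s)
TKFree-dominated s n (M , disj) =
  let i , j , i<j , eq = Fin.pigeonhole ≤-refl (λ i → proj₁ (dom i))
  in proj₁ (disj i j (<⇒≢ i<j ∘ cong toℕ))
       (Fin.toℕ-injective (trans (proj₂ (dom i)) (trans (cong toℕ eq) (≡.sym (proj₂ (dom j))))))
  where
  open Dominated s 0 n
  dom : ∀ i → Dominating (M i)
  dom i with kind (M i)
  ... | inj₁ d = d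
  ... | inj₂ (() , _)

module HGoodDominated (r n : ℕ) (big : suc r + suc r < n) where
  s = suc r
  open Dominated s s n

  extra : Fin s → Edge (graph n)
  extra a = mkEdge {i = s} {suc (s + toℕ a)} (≤-trans (s≤s (m≤m+n s s)) big)
    (<-≤-trans (s≤s (+-monoʳ-< s (Fin.toℕ<n a))) big)
    (dominated-star s s (Fin.toℕ<n a))

  extra₁ : ∀ a → toℕ (end₁ (extra a)) ≡ s
  extra₁ a = Fin.toℕ-fromℕ< _

  extra₂ : ∀ a → toℕ (end₂ (extra a)) ≡ suc (s + toℕ a)
  extra₂ a = Fin.toℕ-fromℕ< _

  -- Common image of the extra edges. As `s = suc r`, vertex 0 is dominating; the extra edges start
  -- at `s`, so none is mapped to itself.
  first : Edge (graph n)
  first = mkEdge {i = 0} {1} (≤-trans (s≤s z≤n) big) (≤-trans (s≤s (s≤s z≤n)) big) refl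

  image : ∀ e → Dominating e ⊎ Extra e → Edge (graph n)
  image e (inj₁ (a , _)) = extra a
  image e (inj₂ _) = first

  label : ∀ e → Dominating e ⊎ Extra e → Fin s
  label e (inj₁ (a , _)) = a
  label e (inj₂ (b , _)) = b

  image≢ : ∀ e (κ : Dominating e ⊎ Extra e) → ¬ SameEdge {G = graph n} (image e κ) e
  image≢ e (inj₁ (a , e₁)) same = <⇒≢ (Fin.toℕ<n a)
    (trans (≡.sym e₁) (trans (cong (toℕ ∘ proj₁) (≡.sym same)) (extra₁ a)))
  image≢ e (inj₂ (b , e₁ , _)) same = contradiction
    (trans (≡.sym (Fin.toℕ-fromℕ< _)) (trans (cong (toℕ ∘ proj₁) same) e₁)) λ ()

  extra-same : ∀ {e} a → toℕ (end₁ e) ≡ s → toℕ (end₂ e) ≡ suc (s + toℕ a) → SameEdge {G = graph n} (extra a) e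
  extra-same a e₁ e₂ = cong₂ _,_ (Fin.toℕ-injective (trans (extra₁ a) (≡.sym e₁))) (Fin.toℕ-injective (trans (extra₂ a) (≡.sym e₂)))

  -- Equal labels mean a common dominating vertex, the common vertex `s` of two extra edges, or a
  -- dominating edge together with its image. There are only `s` labels for the `suc s` edges of a
  -- matching.
  clash : ∀ e e' (κ : Dominating e ⊎ Extra e) (κ' : Dominating e' ⊎ Extra e') → label e κ ≡ label e' κ' →
          end₁ e ≡ end₁ e' ⊎ SameEdge {G = graph n} (image e κ) e' ⊎ SameEdge {G = graph n} (image e' κ') e
  clash e e' (inj₁ (a , e₁)) (inj₁ (.a , e₁')) refl = inj₁ (Fin.toℕ-injective (trans e₁ (≡.sym e₁')))
  clash e e' (inj₂ (b , e₁ , _)) (inj₂ (.b , e₁' , _)) refl = inj₁ (Fin.toℕ-injective (trans e₁ (≡.sym e₁')))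
  clash e e' (inj₁ (a , _)) (inj₂ (.a , e₁' , e₂')) refl = inj₂ (inj₁ (extra-same {e'} a e₁' e₂'))
  clash e e' (inj₂ (b , e₁ , e₂)) (inj₁ (.b , _)) refl = inj₂ (inj₂ (extra-same {e} b e₁ e₂))

  good : HGood (graph n) (suc s)
  good = ((λ e → image e (kind e)) , λ e → image≢ e (kind e)) , λ { ((M , disj) , free) →
    let i , j , i<j , eq = Fin.pigeonhole ≤-refl (λ i → label (M i) (kind (M i)))
    in [ proj₁ (disj i j (<⇒≢ i<j ∘ cong toℕ)) , [ free i j , free j i ]′ ]′ (clash (M i) (M j) (kind (M i)) (kind (M j)) eq) }

-- Explicit maps on 4, 5 and 6 vertices

_≟ᴾ_ : ∀ {n} (p p' : Fin n × Fin n) → Dec (p ≡ p')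
_≟ᴾ_ = Product.≡-dec Fin._≟_ Fin._≟_

-- The map is given on all pairs of vertices, which turns both conditions into finite checks.
module Table {n : ℕ} (G : Graph n) (h : Fin n → Fin n → Fin n × Fin n) where

  IntoEdges Covering : Set
  IntoEdges = ∀ i j → IsEdge G (i , j) → IsEdge G (h i j) × h i j ≢ (i , j)
  Covering = ∀ i j → IsEdge G (i , j) → ∀ k l → IsEdge G (k , l) → Apart i j k l → h i j ≡ (k , l) ⊎ h k l ≡ (i , j)

  intoEdges? : Dec IntoEdges
  intoEdges? = Fin.all? λ i → Fin.all? λ j → isEdge? G (i , j) →-dec (isEdge? G (h i j) ×-dec ¬? (h i j ≟ᴾ (i , j)))

  covering? : Dec Covering
  covering? = Fin.all? λ i → Fin.all? λ j → isEdge? G (i , j) →-dec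
    Fin.all? λ k → Fin.all? λ l → isEdge? G (k , l) →-dec
      ((¬? (i Fin.≟ k) ×-dec ¬? (i Fin.≟ l) ×-dec ¬? (j Fin.≟ k) ×-dec ¬? (j Fin.≟ l)) →-dec
        ((h i j ≟ᴾ (k , l)) ⊎-dec (h k l ≟ᴾ (i , j))))

  table-good : IntoEdges → Covering → HGood G 2
  table-good into cov =
    ( (λ { ((i , j) , ij) → h i j , proj₁ (into i j ij) }) , λ { ((i , j) , ij) → proj₂ (into i j ij) })
    , λ { ((M , disj) , free) →
          [ free 0F 1F , free 1F 0F ]′ (cov _ _ (proj₂ (M 0F)) _ _ (proj₂ (M 1F)) (disj 0F 1F λ ())) }

-- K₄ on 0, 1, 2, 3, with the pendant edge {0, 4}; on four vertices this is K₄.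
pendant : ℕ → ℕ → Bool
pendant i       zero    = false
pendant zero    (suc j) = j <ᵇ 4
pendant (suc i) (suc j) = (i <ᵇ j) ∧ (j <ᵇ 3)

pendant⇒< : ∀ i j → pendant i j ≡ true → i < j
pendant⇒< zero    (suc j) _ = s≤s z≤n
pendant⇒< (suc i) (suc j) eq with i <ᵇ j in lt
... | true = s≤s (<ᵇ⇒< i j (subst IsTrue (≡.sym lt) _))

open Upward pendant pendant⇒< using () renaming (graph to pendantGraph)

-- On edges this swaps the two members of each perfect matching of K₄; these are the only disjoint
-- pairs.
opposite₄ : Fin 4 → Fin 4 → Fin 4 × Fin 4
opposite₄ 0F 1F = 2F , 3F
opposite₄ 0F 2F = 1F , 3F
opposite₄ 0F _  = 1F , 2F
opposite₄ 1F 2F = 0F , 3F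
opposite₄ 1F _  = 0F , 2F
opposite₄ _  _  = 0F , 1F

-- Disjoint pairs are the opposite edges of K₄ and the pendant edge with an edge of the triangle 1,
-- 2, 3. The edges of K₄ at 0 take care of the former, the edges of the triangle of the latter.
toPendant : ∀ {m} → Fin (5 + m) → Fin (5 + m) → Fin (5 + m) × Fin (5 + m)
toPendant 0F 1F = 2F , 3F
toPendant 0F 2F = 1F , 3F
toPendant 0F _  = 1F , 2F
toPendant _  _  = 0F , 4F

HGood-4 : HGood (pendantGraph 4) 2
HGood-4 = table-good (toWitness {a? = intoEdges?} _) (toWitness {a? = covering?} _)
  where open Table (pendantGraph 4) opposite₄

HGood-5 : HGood (pendantGraph 5) 2
HGood-5 = table-good (toWitness {a? = intoEdges?} _) (toWitness {a? = covering?} _)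
  where open Table (pendantGraph 5) toPendant

HGood-6 : HGood (pendantGraph 6) 2
HGood-6 = table-good (toWitness {a? = intoEdges?} _) (toWitness {a? = covering?} _)
  where open Table (pendantGraph 6) toPendant

-- Exact values for t = 2 and for large n

numEdges-4 : (G : Graph 4) → numEdges G ≤ 6
numEdges-4 G = count-mono (isEdge? G) (λ p → proj₁ p Fin.<? proj₂ p) (cartesianProduct (allFin 4) (allFin 4)) (λ _ → proj₁)

small-upper : ∀ {n} → n ≤ 7 → (G : Graph n) → HGood G 2 → numEdges G ≤ 7
small-upper n≤7 G good with 8 ≤? numEdges G
... | yes m≥8 = ≤-trans (HGood₂-upper G good m≥8) n≤7
... | no m≱8 = ≤-pred (≰⇒> m≱8)

isH₂ : ∀ n → 7 ≤ n → IsH n 2 n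
isH₂ n@(suc m) n≥7 =
  -- A spanning star and one further edge.
  (Dominated.graph 1 1 n n , HGoodDominated.good 0 n (≤-trans (s≤s (s≤s (s≤s z≤n))) n≥7)
    , trans (Dominated.numEdges-dominated 1 1 n (≤-trans (s≤s (s≤s (s≤s z≤n))) n≥7)) count≡n)
  , upper
  where
  count≡n : m + 0 + 0 + 1 ≡ suc m
  count≡n = trans (cong (λ x → x + 0 + 1) (+-identityʳ m)) (trans (cong (_+ 1) (+-identityʳ m)) (+-comm m 1))
  upper : ∀ G → HGood G 2 → numEdges G ≤ n
  upper G good with 8 ≤? numEdges G
  ... | yes m≥8 = HGood₂-upper G good m≥8
  -- Fewer than eight edges are at most 7, hence at most `n`.
  ... | no m≱8 = ≤-trans (≤-pred (≰⇒> m≱8)) n≥7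

-- The first summand makes the edges avoiding all vertices of high degree negligible; the second leaves room for
-- the extremal graph.
largeOrder : ℕ → ℕ
largeOrder s = (lowThreshold (suc s) + s) + suc (s + s)

module LargeOrder (s n : ℕ) (large : largeOrder s ≤ n) where

  n-big : lowThreshold (suc s) + s ≤ n
  n-big = ≤-trans (m≤m+n _ _) large

  s+s<n : s + s < n
  s+s<n = ≤-trans (m≤n+m (suc (s + s)) (lowThreshold (suc s) + s)) large

  s<n : s < n
  s<n = ≤-trans (s≤s (m≤m+n s s)) s+s<n

  n∸t+1≡n∸s : n ∸ suc s + 1 ≡ n ∸ s
  n∸t+1≡n∸s = trans (+-comm (n ∸ suc s) 1) (≡.sym (+-∸-assoc 1 s<n))

  touching≡ : touching n s ≡ s * (n ∸ suc s + 1) + s C 2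
  touching≡ = trans (cong (λ n → touching n s) (≡.sym (m+[n∸m]≡n (<⇒≤ s<n))))
    (trans (touching-formula s (n ∸ s)) (cong (λ x → s * x + s C 2) (≡.sym n∸t+1≡n∸s)))

  numEdges≡ : ∀ k → s + k < n → numEdges (Dominated.graph s k n n) ≡ s * (n ∸ suc s + 1) + s C 2 + k
  numEdges≡ k lt = trans (Dominated.numEdges-dominated s k n lt) (cong (λ x → s * x + s C 2 + k) (≡.sym n∸t+1≡n∸s))

  isEx : IsEx n (suc s) (s * (n ∸ suc s + 1) + s C 2)
  isEx = (Dominated.graph s 0 n n , TKFree-dominated s n
         , trans (numEdges≡ 0 (≤-trans (s≤s (≤-reflexive (+-identityʳ s))) s<n)) (+-identityʳ _))
       , λ G free → ≤-trans (TKFree-upper s n-big G free) (≤-reflexive touching≡)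

isH : ∀ r n → largeOrder (suc r) ≤ n → IsH n (suc (suc r)) (suc r * (n ∸ suc (suc r) + 1) + suc r C 2 + suc r)
isH r n large =
  (Dominated.graph s s n n , HGoodDominated.good r n s+s<n , numEdges≡ s s+s<n)
  , λ G good → ≤-trans (HGood-upper s n-big G good) (≤-reflexive (cong (_+ s) touching≡))
  where
  s = suc r
  open LargeOrder s n large

theorem1p1 : ((∀ (n : ℕ) → 7 ≤ n → IsH n 2 n) × IsH 4 2 6 × IsH 5 2 7 × IsH 6 2 7)
    × (∀ (t : ℕ) → 3 ≤ t → Σ ℕ λ nt → ∀ (n : ℕ) → nt ≤ n →
    IsEx n t ((t ∸ 1) * (n ∸ t + 1) + (t ∸ 1) C 2)
    × IsH n t ((t ∸ 1) * (n ∸ t + 1) + (t ∸ 1) C 2 + (t ∸ 1)))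
theorem1p1 =
  ( isH₂
  , ((pendantGraph 4 , HGood-4 , refl) , λ G _ → numEdges-4 G)
  , ((pendantGraph 5 , HGood-5 , refl) , small-upper (s≤s (s≤s (s≤s (s≤s (s≤s z≤n))))))
  , ((pendantGraph 6 , HGood-6 , refl) , small-upper (s≤s (s≤s (s≤s (s≤s (s≤s (s≤s z≤n))))))))
  , λ { (suc s@(suc r)) _ → largeOrder s , λ n large → LargeOrder.isEx s n large , isH r n large
      ; (suc zero) (s≤s ()) }
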